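{- In the unweighted offline interval scheduling problem on $m$ identical machines there is a polynomial-time algorithm $\mathrm{ALG}$ which, given $m\ge 1$ and any finite instance $\mathcal I$ of unit-weight intervals, outputs an EF1 schedule $\mathrm{ALG}(\mathcal I)$ of $\mathcal I$ on $m$ machines, and whose price of fairness is at most $3/2$; that is, for every instance $\mathcal I$, $$|\mathrm{OPT}(\mathcal I)|\;\le\;\tfrac32\,|\mathrm{ALG}(\mathcal I)| .$$
   Context: An instance $\mathcal I$ is a finite indexed family of intervals $I_1,\dots,I_n$ (identical intervals may occur several times). Interval $I_j$ has a start time $s_j$ and an end time $e_j$, $s_j<e_j$, both nonnegative rationals, and is identified with the half-open set $[s_j,e_j)$. Two intervals overlap (conflict) if these sets intersect. Unweighted means every interval has weight $1$. Machines are $1,\dots,m$. A schedule assigns a subset of the intervals to machines (each accepted interval to exactly one machine; intervals may be left unassigned) so that no two intervals on the same machine overlap. $S_i$ is the set of intervals assigned to machine $i$, and the size $|\cdot|$ of a schedule is its number of assigned intervals. $\mathrm{OPT}(\mathcal I)$ is a schedule of maximum size, with no fairness requirement. A schedule is EF1 (envy-free up to one interval) if for every pair of machines $i\ne k$ with $S_k\neq\emptyset$ there is $I\in S_k$ such that $u(S_i)\ge u(S_k)-w(I)$, where $u(S)$ is the total weight of $S$; with unit weights this says $|S_i|\ge |S_k|-1$. Offline means the algorithm is given the whole instance in advance. The price of fairness of an offline EF1 algorithm is the smallest $\alpha$ such that $|\mathrm{OPT}(\mathcal I)|\le\alpha|\mathrm{ALG}(\mathcal I)|$ for every instance $\mathcal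 I$. -}

module Defs where

import Algebra.Properties.CommutativeMonoid.Sum
open import Data.Bool using (Bool; true; false; if_then_else_)
open import Data.Fin using (Fin; toℕ)
import Data.Fin as Fin
open import Data.Fin.Subset using (Subset; _∈_; Nonempty; ∣_∣)
import Data.Integer as ℤ
open import Data.List using (List)
import Data.List as List
open import Data.Maybe using (Maybe; just; nothing; is-just)
open import Data.Maybe.Properties using (≡-dec)
open import Data.Nat using (ℕ; suc; _+_; _*_; _^_; _≤_; NonZero)
open import Data.Nat.Logarithm using (⌊log₂_⌋)
open import Data.Product using (∃-syntax; Σ-syntax; _×_)
open import Data.Rational using (ℚ; 0ℚ; 1ℚ; ↥_; ↧ₙ_)
import Data.Rational as ℚ
open import Data.Rational.Literals using (fromℤ)
open import Data.Rational.Properties using (+-0-commutativeMonoid)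
open import Data.Vec using (Vec; []; _∷_; lookup)
import Data.Vec as Vec
open import Relation.Binary.PropositionalEquality using (_≡_; _≢_)
open import Relation.Nullary using (¬_; does)

fromℕ : ℕ → ℚ
fromℕ n = fromℤ (ℤ.+ n)

record Interval : Set where
  field
    start       : ℚ
    end         : ℚ
    nonNegative : 0ℚ ℚ.≤ start
    start<end   : start ℚ.< end

open Interval public

infix 4 _∈ᴵ_

_∈ᴵ_ : ℚ → Interval → Set
x ∈ᴵ I = start I ℚ.≤ x × x ℚ.< end I

-- Rational points suffice: if [s,e) and [s′,e′) share any real point, they
-- share the rational point max(s,s′).
Overlap : Interval → Interval → Set
Overlap I J = ∃[ x ] x ∈ᴵ I × x ∈ᴵ J

Instance : ℕ → Set
Instance n = Vec Interval n

Assignment : ℕ → ℕ → Set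
Assignment m n = Vec (Maybe (Fin m)) n

-- S_i, as a set of indices, so that identical intervals stay distinct.
assignedTo : ∀ {m n} → Assignment m n → Fin m → Subset n
assignedTo a i = Vec.map (λ x → does (≡-dec Fin._≟_ x (just i))) a

record Schedule (m : ℕ) {n : ℕ} (I : Instance n) : Set where
  field
    assignment : Assignment m n
    noOverlap  : ∀ i {j k} → j ∈ assignedTo assignment i →
                 k ∈ assignedTo assignment i → j ≢ k →
                 ¬ Overlap (lookup I j) (lookup I k)

  machine : Fin m → Subset n
  machine = assignedTo assignment

  size : ℕ
  size = ∣ Vec.map is-just assignment ∣

open Schedule public

Weights : ℕ → Set
Weights n = Fin n → ℚ

unitWeights : ∀ {n} → Weights n
unitWeights _ = 1ℚ

utility : ∀ {n} → Weights n → Subset n → ℚ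
utility w S = sum (λ j → if lookup S j then w j else 0ℚ)
  where open Algebra.Properties.CommutativeMonoid.Sum +-0-commutativeMonoid
          using (sum)

EF1 : ∀ {m n} {I : Instance n} → Weights n → Schedule m I → Set
EF1 w S = ∀ i k → i ≢ k → Nonempty (machine S k) →
  ∃[ j ] j ∈ machine S k ×
         utility w (machine S k) ℚ.- w j ℚ.≤ utility w (machine S i)

IsOptimal : ∀ {m n} {I : Instance n} → Schedule m I → Set
IsOptimal {m} {I = I} S = (T : Schedule m I) → size T ≤ size S

OfflineAlgorithm : Set
OfflineAlgorithm =
  (m : ℕ) .{{_ : NonZero m}} {n : ℕ} (I : Instance n) → Schedule m I

PriceOfFairnessAtMost : ℚ → OfflineAlgorithm → Set
PriceOfFairnessAtMost α ALG =
  (m : ℕ) .{{_ : NonZero m}} {n : ℕ} (I : Instance n)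
  (OPT : Schedule m I) → IsOptimal OPT →
  fromℕ (size OPT) ℚ.≤ α ℚ.* fromℕ (size (ALG m I))

-- Model of computation: while programs (with local variables) over binary
-- trees whose leaves are nil or rational numbers.
--
-- Every elementary operation costs one step.  Cells are shared, so nil, cons,
-- hd and tl take constant time on a pointer machine.  The only arithmetic is
-- +, - and ≤: after t steps every number is an integer combination of input
-- numbers and program constants with coefficients of absolute value at most
-- 2 ^ t, so its bit length is at most linear in t plus the input size.  Hence
-- a polynomial number of steps is the same as polynomial time on a Turing
-- machine; with multiplication as a unit-cost operation this would fail.

data Value : Set where
  nil  : Value
  num  : ℚ → Value
  cons : Value → Value → Value

-- As is usual for such languages, operations applied to operands of the wrong
-- shape return nil.

head tail : Value → Value
head (cons u _) = u
head _          = nil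
tail (cons _ v) = v
tail _          = nil

arith : (ℚ → ℚ → ℚ) → Value → Value → Value
arith _⊕_ (num p) (num q) = num (p ⊕ q)
arith _   _       _       = nil

truth : Bool → Value
truth false = nil
truth true  = cons nil nil

compare : Value → Value → Value
compare (num p) (num q) = truth (p ℚ.≤ᵇ q)
compare _       _       = nil

isTrue : Value → Bool
isTrue nil = false
isTrue _   = true

-- Variables are de Bruijn indices.  call f e runs the closed program f on the
-- value of e.  while c b repeats variable 0 := b for as long as c is true and
-- returns the final value of variable 0.
data Exp : ℕ → Set where
  var         : ∀ {n} → Fin n → Exp n
  nil         : ∀ {n} → Exp n
  num         : ∀ {n} → ℚ → Exp n
  cons        : ∀ {n} → Exp n → Exp n → Exp n
  hd tl       : ∀ {n} → Exp n → Exp n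
  add sub leq : ∀ {n} → Exp n → Exp n → Exp n
  if          : ∀ {n} → Exp n → Exp n → Exp n → Exp n
  let′        : ∀ {n} → Exp n → Exp (suc n) → Exp n
  call        : ∀ {n} → Exp 1 → Exp n → Exp n
  while       : ∀ {n} → Exp (suc n) → Exp (suc n) → Exp (suc n)

Program : Set
Program = Exp 1

infix 4 _⊢_⇓_[_]

-- Big-step semantics; ρ ⊢ e ⇓ v [ t ] says that, in environment ρ, e terminates with
-- value v in t steps.
data _⊢_⇓_[_] : ∀ {n} → Vec Value n → Exp n → Value → ℕ → Set where

  ⇓var : ∀ {n} {ρ : Vec Value n} x → ρ ⊢ var x ⇓ lookup ρ x [ 1 ]

  ⇓nil : ∀ {n} {ρ : Vec Value n} → ρ ⊢ nil ⇓ nil [ 1 ]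

  ⇓num : ∀ {n} {ρ : Vec Value n} q → ρ ⊢ num q ⇓ num q [ 1 ]

  ⇓cons : ∀ {n} {ρ : Vec Value n} {e f u v s t} →
          ρ ⊢ e ⇓ u [ s ] → ρ ⊢ f ⇓ v [ t ] →
          ρ ⊢ cons e f ⇓ cons u v [ suc (s + t) ]

  ⇓hd : ∀ {n} {ρ : Vec Value n} {e v t} →
        ρ ⊢ e ⇓ v [ t ] → ρ ⊢ hd e ⇓ head v [ suc t ]

  ⇓tl : ∀ {n} {ρ : Vec Value n} {e v t} →
        ρ ⊢ e ⇓ v [ t ] → ρ ⊢ tl e ⇓ tail v [ suc t ]

  ⇓add : ∀ {n} {ρ : Vec Value n} {e f u v s t} →
         ρ ⊢ e ⇓ u [ s ] → ρ ⊢ f ⇓ v [ t ] →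
         ρ ⊢ add e f ⇓ arith ℚ._+_ u v [ suc (s + t) ]

  ⇓sub : ∀ {n} {ρ : Vec Value n} {e f u v s t} →
         ρ ⊢ e ⇓ u [ s ] → ρ ⊢ f ⇓ v [ t ] →
         ρ ⊢ sub e f ⇓ arith ℚ._-_ u v [ suc (s + t) ]

  ⇓leq : ∀ {n} {ρ : Vec Value n} {e f u v s t} →
         ρ ⊢ e ⇓ u [ s ] → ρ ⊢ f ⇓ v [ t ] →
         ρ ⊢ leq e f ⇓ compare u v [ suc (s + t) ]

  ⇓if-true : ∀ {n} {ρ : Vec Value n} {c e f u v s t} →
             ρ ⊢ c ⇓ u [ s ] → isTrue u ≡ true → ρ ⊢ e ⇓ v [ t ] →
             ρ ⊢ if c e f ⇓ v [ suc (s + t) ]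

  ⇓if-false : ∀ {n} {ρ : Vec Value n} {c e f u v s t} →
              ρ ⊢ c ⇓ u [ s ] → isTrue u ≡ false → ρ ⊢ f ⇓ v [ t ] →
              ρ ⊢ if c e f ⇓ v [ suc (s + t) ]

  ⇓let : ∀ {n} {ρ : Vec Value n} {e f u v s t} →
         ρ ⊢ e ⇓ u [ s ] → u ∷ ρ ⊢ f ⇓ v [ t ] →
         ρ ⊢ let′ e f ⇓ v [ suc (s + t) ]

  ⇓call : ∀ {n} {ρ : Vec Value n} {f e u v s t} →
          ρ ⊢ e ⇓ u [ s ] → u ∷ [] ⊢ f ⇓ v [ t ] →
          ρ ⊢ call f e ⇓ v [ suc (s + t) ]

  ⇓while-stop : ∀ {n} {ρ : Vec Value n} {c b u w s} →
                w ∷ ρ ⊢ c ⇓ u [ s ] → isTrue u ≡ false →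
                w ∷ ρ ⊢ while c b ⇓ w [ suc s ]

  ⇓while-step : ∀ {n} {ρ : Vec Value n} {c b u w w′ v r s t} →
                w ∷ ρ ⊢ c ⇓ u [ r ] → isTrue u ≡ true →
                w ∷ ρ ⊢ b ⇓ w′ [ s ] → w′ ∷ ρ ⊢ while c b ⇓ v [ t ] →
                w ∷ ρ ⊢ while c b ⇓ v [ suc (r + s + t) ]

encodeList : List Value → Value
encodeList = List.foldr cons nil

encodeInterval : Interval → Value
encodeInterval I = cons (num (start I)) (num (end I))

encodeInput : ∀ {n} → ℕ → Instance n → Value
encodeInput m I =
  cons (num (fromℕ m)) (encodeList (Vec.toList (Vec.map encodeInterval I)))

encodeMachine : ∀ {m} → Maybe (Fin m) → Value
encodeMachine nothing  = nil
encodeMachine (just i) = num (fromℕ (toℕ i))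

encodeSchedule : ∀ {m n} {I : Instance n} → Schedule m I → Value
encodeSchedule S =
  encodeList (Vec.toList (Vec.map encodeMachine (assignment S)))

bits : ℕ → ℕ
bits n = suc ⌊log₂ n ⌋

-- Numbers are written in binary; in particular m counts with only about
-- log₂ m towards the size of the input.
inputLength : Value → ℕ
inputLength nil        = 1
inputLength (num q)    = bits ℤ.∣ ↥ q ∣ + bits (↧ₙ q)
inputLength (cons u v) = suc (inputLength u + inputLength v)

-- One program for all m and all instances, with running time O(Nᵈ) in the
-- length N of the input.
PolynomialTime : OfflineAlgorithm → Set
PolynomialTime ALG =
  Σ[ P ∈ Program ] ∃[ c ] ∃[ d ]
  ((m : ℕ) .{{_ : NonZero m}} {n : ℕ} (I : Instance n) →
   ∃[ t ] encodeInput m I ∷ [] ⊢ P ⇓ encodeSchedule (ALG m I) [ t ]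
        × t ≤ c * inputLength (encodeInput m I) ^ d)

{-# OPTIONS --safe #-}

-- The schedule is an optimal one, rebalanced.  Without the fairness
-- requirement, processing the intervals by end time and giving each to the
-- machine that became idle last among those that can take it is optimal:
-- compared with any other schedule, the greedy one has at each time at most as
-- many fewer idle machines as it has accepted more intervals.
--
-- Rebalancing fixes one machine at a time.  Let τ be the average load of the
-- remaining machines, rounded down, and take loads |a| ≤ τ < |b|.  Cutting
-- both at a time t that is an end time of b and exchanging the parts after t
-- gives a machine of load exactly τ for a suitable t, because moving t back by
-- one interval of b lowers that load by at most one.  At most one interval,
-- of a, contains t in its interior and is lost, and none if |a| = τ; so a loss
-- needs 1 ≤ |a| < τ, and an interval is lost only against τ ≥ 2 intervals that
-- are kept.  Hence at most a third of the optimum is lost.  Rounding down keeps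
-- all loads within one of each other, as a loss lowers the average by too
-- little to leave the current pair of consecutive values twice.
module Submission where

open import Defs
import Algebra.Properties.CommutativeMonoid.Sum
open import Data.Bool using (Bool; true; false; if_then_else_; _∧_)
open import Data.Empty using (⊥)
open import Data.Fin using (Fin; zero; suc; toℕ; #_)
import Data.Fin as Fin
import Data.Fin.Properties as Finₚ
open import Data.Fin.Subset using (Subset; ∣_∣)
import Data.Fin.Subset as Subset
open import Data.Fin.Subset.Properties using (∣p∣≤n)
open import Data.Integer using (-[1+_])
import Data.Integer as ℤ
import Data.Integer.Properties as ℤₚ
open import Data.List using (List; []; _∷_; [_]; _++_; _ʳ++_; allFin; drop; filter; foldr; length; map; replicate; reverse; tabulate)
open import Data.List.Membership.Propositional using (_∈_)
open import Data.List.Properties using (++-assoc; ++-identityʳ; filter-accept; filter-all; filter-none; length-++; length-filter; length-map; length-replicate; length-reverse; length-tabulate; map-tabulate; reverse-involutive; tabulate-cong)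
open import Data.List.Relation.Binary.Permutation.Propositional using (↭-sym)
open import Data.List.Relation.Binary.Permutation.Propositional.Properties using (↭-reverse; All-resp-↭)
open import Data.List.Relation.Unary.All using (All; []; _∷_)
import Data.List.Relation.Unary.All as All
import Data.List.Relation.Unary.All.Properties as Allₚ
open import Data.List.Relation.Unary.AllPairs using (AllPairs; []; _∷_)
import Data.List.Relation.Unary.AllPairs.Properties as AllPairsₚ
open import Data.List.Relation.Unary.Any using (here; there)
open import Data.Maybe using (Maybe; just; nothing; is-just)
import Data.Maybe as Maybe
open import Data.Maybe.Properties using (≡-dec)
open import Data.Nat using (ℕ; zero; suc; _+_; _*_; _^_; _∸_; _⊓_; _≤_; _<_; z≤n; s≤s; NonZero; >-nonZero; >-nonZero⁻¹)
open import Data.Nat.Properties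
open import Data.Nat.Solver using (module +-*-Solver)
open import Data.Product using (∃-syntax; Σ-syntax; _×_; _,_; proj₁; proj₂)
open import Data.Rational using (ℚ; 0ℚ; 1ℚ)
import Data.Rational as ℚ
import Data.Rational.Properties as ℚₚ
open import Data.Sum using (_⊎_; inj₁; inj₂)
open import Data.Unit using (⊤; tt)
open import Data.Vec using (Vec; []; _∷_; lookup)
import Data.Vec as Vec
import Data.Vec.Properties as Vecₚ
open import Function using (_∘_; const)
open import Relation.Binary.PropositionalEquality hiding ([_])
open import Relation.Nullary using (Dec; does; yes; no; ¬_; ¬?; contradiction)
open import Relation.Nullary.Decidable using (_×-dec_; dec-true)
open import Relation.Unary using (Decidable)
open Algebra.Properties.CommutativeMonoid.Sum +-0-commutativeMonoid
  using (sum; sum-remove; sum-cong-≗; ∑-distrib-+; sum-replicate-zero)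

-- The length of the input grows only with the logarithm of `m`, so `m` machines cannot in general
-- be set up in polynomial time. If `m` is at least the number `n` of intervals, each interval gets
-- a machine of its own; otherwise at most `n` machines are ever listed.
--
-- The schedule is defined by folds and filters over lists, because each of these has a program
-- template whose correctness and cost are proved once. Hence a loop that runs until a condition
-- holds appears as a step that changes nothing once it holds, repeated along a list whose elements
-- are ignored and whose length is a sufficient number of rounds. The cost can then be read off the
-- program text, as long as every list looped over has length at most `n`; the invariants of the
-- rebalancing also serve to show this.
--
-- That no interval is used twice is expressed by inequalities between total weights for all weights
-- `w : Fin n → ℕ` at once, which survive filtering, splitting and exchanging by the same few lemmas
-- on sums.

-- Natural numbers among the rationals

fromℕ≗/1 : ∀ n → fromℕ n ≡ (ℤ.+ n) ℚ./ 1
fromℕ≗/1 n = sym (ℚₚ.↥p/↧p≡p (fromℕ n))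

fromℕ-+ : ∀ m n → fromℕ m ℚ.+ fromℕ n ≡ fromℕ (m + n)
fromℕ-+ m n = trans (cong (ℚ._/ 1) (cong₂ ℤ._+_ (ℤₚ.*-identityʳ (ℤ.+ m)) (ℤₚ.*-identityʳ (ℤ.+ n))))
                    (sym (fromℕ≗/1 (m + n)))

ℤ-≤ᵇ≡does : ∀ i j → (i ℤ.≤ᵇ j) ≡ does (i ℤₚ.≤? j)
ℤ-≤ᵇ≡does (ℤ.+ m)  (ℤ.+ n)   = refl
ℤ-≤ᵇ≡does (ℤ.+ m)  -[1+ n ]  = refl
ℤ-≤ᵇ≡does -[1+ m ] (ℤ.+ n)   = refl
ℤ-≤ᵇ≡does -[1+ m ] -[1+ n ]  = refl

-- Programs compare with `≤ᵇ`, while the schedule branches on `does` of a decision; the two Booleans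
-- must be identified before a program can be matched with its specification.
ℚ-≤ᵇ≡does : ∀ p q → (p ℚ.≤ᵇ q) ≡ does (p ℚₚ.≤? q)
ℚ-≤ᵇ≡does p q = ℤ-≤ᵇ≡does (ℚ.↥ p ℤ.* ℚ.↧ q) (ℚ.↥ q ℤ.* ℚ.↧ p)

fromℕ-≤ᵇ : ∀ m n → (fromℕ m ℚ.≤ᵇ fromℕ n) ≡ does (m ≤? n)
fromℕ-≤ᵇ m n = cong₂ ℤ._≤ᵇ_ (ℤₚ.*-identityʳ (ℤ.+ m)) (ℤₚ.*-identityʳ (ℤ.+ n))

fromℕ-mono-≤ : ∀ {m n} → m ≤ n → fromℕ m ℚ.≤ fromℕ n
fromℕ-mono-≤ {m} {n} m≤n = ℚ.*≤* (subst₂ ℤ._≤_ (sym (ℤₚ.*-identityʳ (ℤ.+ m))) (sym (ℤₚ.*-identityʳ (ℤ.+ n))) (ℤ.+≤+ m≤n))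

-- Time bounds read off the program text

-- Charges K + 1 tests to each loop; all loops run over lists of length at most
-- K, the length of the input.
timeBound : ∀ {n} → ℕ → Exp n → ℕ
timeBound K (var x)      = 1
timeBound K nil          = 1
timeBound K (num q)      = 1
timeBound K (cons e f)   = suc (timeBound K e + timeBound K f)
timeBound K (hd e)       = suc (timeBound K e)
timeBound K (tl e)       = suc (timeBound K e)
timeBound K (add e f)    = suc (timeBound K e + timeBound K f)
timeBound K (sub e f)    = suc (timeBound K e + timeBound K f)
timeBound K (leq e f)    = suc (timeBound K e + timeBound K f)
timeBound K (if c e f)   = suc (timeBound K c + (timeBound K e + timeBound K f))
timeBound K (let′ e f)   = suc (timeBound K e + timeBound K f)
timeBound K (call f e)   = suc (timeBound K e + timeBound K f)
timeBound K (while c b)  = suc K * suc (timeBound K c + timeBound K b)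

-- For nonzero `K` the powers `K ^ d` do not decrease with `d`; this lets two bounds be summed over
-- a common degree, the sum of the two.
record PolyBounded (f : ℕ → ℕ) : Set where
  field
    coefficient degree : ℕ
    bounded : ∀ K → .{{_ : NonZero K}} → f K ≤ coefficient * K ^ degree

private
  K^-mono : ∀ K .{{_ : NonZero K}} {d e} → d ≤ e → K ^ d ≤ K ^ e
  K^-mono K = ^-monoʳ-≤ K

poly-const : ∀ k → PolyBounded (const k)
poly-const k = record { coefficient = k; degree = 0; bounded = λ K → ≤-reflexive (sym (*-identityʳ k)) }

poly-+ : ∀ {f g} → PolyBounded f → PolyBounded g → PolyBounded (λ K → f K + g K)
poly-+ {f} {g} p q = record
  { coefficient = P.coefficient + Q.coefficient
  ; degree = P.degree + Q.degree
  ; bounded = λ K → begin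
      f K + g K ≤⟨ +-mono-≤ (P.bounded K) (Q.bounded K) ⟩
      P.coefficient * K ^ P.degree + Q.coefficient * K ^ Q.degree
        ≤⟨ +-mono-≤ (*-monoʳ-≤ P.coefficient (K^-mono K (m≤m+n P.degree Q.degree)))
                    (*-monoʳ-≤ Q.coefficient (K^-mono K (m≤n+m Q.degree P.degree))) ⟩
      P.coefficient * K ^ (P.degree + Q.degree) + Q.coefficient * K ^ (P.degree + Q.degree)
        ≡⟨ sym (*-distribʳ-+ (K ^ (P.degree + Q.degree)) P.coefficient Q.coefficient) ⟩
      (P.coefficient + Q.coefficient) * K ^ (P.degree + Q.degree) ∎
  }
  where
  module P = PolyBounded p
  module Q = PolyBounded q
  open ≤-Reasoning

poly-suc : ∀ {f} → PolyBounded f → PolyBounded (λ K → suc (f K))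
poly-suc = poly-+ (poly-const 1)

poly-K* : ∀ {f} → PolyBounded f → PolyBounded (λ K → K * f K)
poly-K* {f} p = record
  { coefficient = P.coefficient
  ; degree = suc P.degree
  ; bounded = λ K → begin
      K * f K                              ≤⟨ *-monoʳ-≤ K (P.bounded K) ⟩
      K * (P.coefficient * K ^ P.degree)   ≡⟨ sym (*-assoc K P.coefficient _) ⟩
      K * P.coefficient * K ^ P.degree     ≡⟨ cong (_* K ^ P.degree) (*-comm K P.coefficient) ⟩
      P.coefficient * K * K ^ P.degree     ≡⟨ *-assoc P.coefficient K _ ⟩
      P.coefficient * K ^ suc P.degree     ∎
  }
  where
  module P = PolyBounded p
  open ≤-Reasoning

timeBound-poly : ∀ {n} (e : Exp n) → PolyBounded (λ K → timeBound K e)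
timeBound-poly (var x)     = poly-const 1
timeBound-poly nil         = poly-const 1
timeBound-poly (num q)     = poly-const 1
timeBound-poly (cons e f)  = poly-suc (poly-+ (timeBound-poly e) (timeBound-poly f))
timeBound-poly (hd e)      = poly-suc (timeBound-poly e)
timeBound-poly (tl e)      = poly-suc (timeBound-poly e)
timeBound-poly (add e f)   = poly-suc (poly-+ (timeBound-poly e) (timeBound-poly f))
timeBound-poly (sub e f)   = poly-suc (poly-+ (timeBound-poly e) (timeBound-poly f))
timeBound-poly (leq e f)   = poly-suc (poly-+ (timeBound-poly e) (timeBound-poly f))
timeBound-poly (if c e f)  = poly-suc (poly-+ (timeBound-poly c) (poly-+ (timeBound-poly e) (timeBound-poly f)))
timeBound-poly (let′ e f)  = poly-suc (poly-+ (timeBound-poly e) (timeBound-poly f))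
timeBound-poly (call f e)  = poly-suc (poly-+ (timeBound-poly e) (timeBound-poly f))
timeBound-poly (while c b) = poly-+ step (poly-K* step)
  where step = poly-suc (poly-+ (timeBound-poly c) (timeBound-poly b))

-- Programs on lists

encodeList-map : ∀ {A : Set} → (A → Value) → List A → Value
encodeList-map enc xs = encodeList (map enc xs)

-- The state of the loop pairs the remaining list with the accumulator; the body
-- sees the accumulator, the current element and the state as variables 0, 1, 2.
loop : ∀ {n} → Exp (suc (suc (suc n))) → Exp n → Exp n → Exp n
loop b l i =
  let′ (cons l i)
       (tl (while (hd (var (# 0)))
                  (let′ (hd (hd (var (# 0))))
                        (let′ (tl (var (# 1))) (cons (tl (hd (var (# 2)))) b)))))

reverseᴾ : ∀ {n} → Exp n → Exp n
reverseᴾ l = loop (cons (var (# 1)) (var (# 0))) l nil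

-- A loop consumes its list from the left. On the reversed list its accumulator runs through the
-- right folds of the suffixes of the original, the form in which the schedule is specified.
foldrᴾ : ∀ {n} → Exp (suc (suc (suc n))) → Exp n → Exp n → Exp n
foldrᴾ b l i = loop b (reverseᴾ l) i

filterᴾ : ∀ {n} → Exp (suc (suc (suc n))) → Exp n → Exp n
filterᴾ p l = foldrᴾ (if p (cons (var (# 1)) (var (# 0))) (var (# 0))) l nil

infixr 5 _++ᴾ_
_++ᴾ_ : ∀ {n} → Exp n → Exp n → Exp n
l ++ᴾ r = foldrᴾ (cons (var (# 1)) (var (# 0))) l r

lengthᴾ : ∀ {n} → Exp n → Exp n
lengthᴾ l = foldrᴾ (add (num 1ℚ) (var (# 0))) l (num 0ℚ)

encodeℕ : ℕ → Value
encodeℕ k = num (fromℕ k)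

encodeBool : ∀ {P : Set} → Dec P → Value
encodeBool P? = truth (does P?)

-- Evaluation within the time bound

module Evaluation (K : ℕ) where

  infix 4 _⊢_↓_
  -- The number of steps is existential and bounded by the expression alone, so evaluation proofs
  -- follow the syntax without computing running times.
  _⊢_↓_ : ∀ {n} → Vec Value n → Exp n → Value → Set
  ρ ⊢ e ↓ v = ∃[ t ] ρ ⊢ e ⇓ v [ t ] × t ≤ timeBound K e

  private variable
    n : ℕ
    ρ : Vec Value n
    e f c : Exp n
    u v w : Value

  varᴱ : ∀ x → ρ ⊢ var x ↓ lookup ρ x
  varᴱ x = 1 , ⇓var x , ≤-refl

  nilᴱ : ρ ⊢ nil ↓ nil
  nilᴱ = 1 , ⇓nil , ≤-refl

  numᴱ : ∀ q → ρ ⊢ num q ↓ num q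
  numᴱ q = 1 , ⇓num q , ≤-refl

  consᴱ : ρ ⊢ e ↓ u → ρ ⊢ f ↓ v → ρ ⊢ cons e f ↓ cons u v
  consᴱ (_ , d , p) (_ , d′ , q) = _ , ⇓cons d d′ , s≤s (+-mono-≤ p q)

  hdᴱ : ρ ⊢ e ↓ v → ρ ⊢ hd e ↓ head v
  hdᴱ (_ , d , p) = _ , ⇓hd d , s≤s p

  tlᴱ : ρ ⊢ e ↓ v → ρ ⊢ tl e ↓ tail v
  tlᴱ (_ , d , p) = _ , ⇓tl d , s≤s p

  addᴱ : ρ ⊢ e ↓ u → ρ ⊢ f ↓ v → ρ ⊢ add e f ↓ arith ℚ._+_ u v
  addᴱ (_ , d , p) (_ , d′ , q) = _ , ⇓add d d′ , s≤s (+-mono-≤ p q)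

  leqᴱ : ρ ⊢ e ↓ u → ρ ⊢ f ↓ v → ρ ⊢ leq e f ↓ compare u v
  leqᴱ (_ , d , p) (_ , d′ , q) = _ , ⇓leq d d′ , s≤s (+-mono-≤ p q)

  letᴱ : ρ ⊢ e ↓ u → (u ∷ ρ) ⊢ f ↓ v → ρ ⊢ let′ e f ↓ v
  letᴱ (_ , d , p) (_ , d′ , q) = _ , ⇓let d d′ , s≤s (+-mono-≤ p q)

  if-trueᴱ : ρ ⊢ c ↓ u → isTrue u ≡ true → ρ ⊢ e ↓ v → ρ ⊢ if c e f ↓ v
  if-trueᴱ (_ , d , p) eq (_ , d′ , q) =
    _ , ⇓if-true d eq d′ , s≤s (+-mono-≤ p (≤-trans q (m≤m+n _ _)))

  if-falseᴱ : ρ ⊢ c ↓ u → isTrue u ≡ false → ρ ⊢ f ↓ v → ρ ⊢ if c e f ↓ v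
  if-falseᴱ (_ , d , p) eq (_ , d′ , q) =
    _ , ⇓if-false d eq d′ , s≤s (+-mono-≤ p (≤-trans q (m≤n+m _ _)))

  ifᴱ : ∀ b → ρ ⊢ c ↓ truth b → ρ ⊢ e ↓ u → ρ ⊢ f ↓ v →
        ρ ⊢ if c e f ↓ (if b then u else v)
  ifᴱ true  d d₁ d₂ = if-trueᴱ d refl d₁
  ifᴱ false d d₁ d₂ = if-falseᴱ d refl d₂

  subst↓ : u ≡ v → ρ ⊢ e ↓ u → ρ ⊢ e ↓ v
  subst↓ refl d = d

  leqℕᴱ : ∀ a b → ρ ⊢ e ↓ encodeℕ a → ρ ⊢ f ↓ encodeℕ b → ρ ⊢ leq e f ↓ encodeBool (a ≤? b)
  leqℕᴱ a b d d′ = subst↓ (cong truth (fromℕ-≤ᵇ a b)) (leqᴱ d d′)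

  leqℚᴱ : ∀ p q → ρ ⊢ e ↓ num p → ρ ⊢ f ↓ num q → ρ ⊢ leq e f ↓ encodeBool (p ℚₚ.≤? q)
  leqℚᴱ p q d d′ = subst↓ (cong truth (ℚ-≤ᵇ≡does p q)) (leqᴱ d d′)

  addℕᴱ : ∀ a b → ρ ⊢ e ↓ encodeℕ a → ρ ⊢ f ↓ encodeℕ b → ρ ⊢ add e f ↓ encodeℕ (a + b)
  addℕᴱ a b d d′ = subst↓ (cong num (fromℕ-+ a b)) (addᴱ d d′)

  module _ {A B : Set} (encA : A → Value) (encB : B → Value) (P : A → Set)
           {f : A → B → B} {i : B} {ρ : Vec Value n} {b : Exp (suc (suc (suc n)))}
           (step : ∀ x ys s → P x → All P ys → length ys < K →
                   (encB (foldr f i ys) ∷ encA x ∷ s ∷ ρ) ⊢ b ↓ encB (f x (foldr f i ys)))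
    where

    private
      cond : Exp (suc n)
      cond = hd (var (# 0))

      body : Exp (suc n)
      body = let′ (hd (hd (var (# 0)))) (let′ (tl (var (# 1))) (cons (tl (hd (var (# 2)))) b))

      body⇓ : ∀ x zs ys → P x → All P ys → length ys < K →
              (cons (encodeList-map encA (x ∷ zs)) (encB (foldr f i ys)) ∷ ρ) ⊢ body ↓
              cons (encodeList-map encA zs) (encB (foldr f i (x ∷ ys)))
      body⇓ x zs ys Px Pys ys<K =
        letᴱ (hdᴱ (hdᴱ (varᴱ (# 0))))
             (letᴱ (tlᴱ (varᴱ (# 1)))
                   (consᴱ (tlᴱ (hdᴱ (varᴱ (# 2)))) (step x ys _ Px Pys ys<K)))

      -- `zs` is still to be read, `ys` has been read, latest first. Time is counted by the elements
      -- left, plus one for the failing test at the end; `K` replaces their number only when the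
      -- loop is complete.
      while⇓ : ∀ zs ys → All P zs → All P ys → length zs + length ys ≤ K →
               ∃[ t ] (cons (encodeList-map encA zs) (encB (foldr f i ys)) ∷ ρ) ⊢ while cond body
                        ⇓ cons nil (encB (foldr f i (zs ʳ++ ys))) [ t ]
                    × t ≤ suc (length zs) * suc (timeBound K cond + timeBound K body)
      while⇓ [] ys Pzs Pys len =
        _ , ⇓while-stop (⇓hd (⇓var (# 0))) refl
          , s≤s (≤-trans (m≤m+n 2 _) (m≤m+n _ 0))
      while⇓ (x ∷ zs) ys (Px ∷ Pzs) Pys len
        with body⇓ x zs ys Px Pys (≤-trans (s≤s (m≤n+m (length ys) (length zs))) len)
           | while⇓ zs (x ∷ ys) Pzs (Px ∷ Pys) (subst (_≤ K) (sym (+-suc (length zs) (length ys))) len)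
      ... | _ , d , p | _ , d′ , q =
        _ , ⇓while-step (⇓hd (⇓var (# 0))) refl d d′ , s≤s (+-mono-≤ (+-monoʳ-≤ 2 p) q)

    -- The predicate `P` and the bound `length ys < K` are meant for bodies with loops of their own:
    -- the former bounds the lists inside the elements, the latter those kept in the accumulator.
    loopᴱ : ∀ {l : Exp n} {j : Exp n} zs → All P zs → length zs ≤ K →
            ρ ⊢ l ↓ encodeList-map encA zs → ρ ⊢ j ↓ encB i →
            ρ ⊢ loop b l j ↓ encB (foldr f i (reverse zs))
    loopᴱ zs Pzs len d d′
      with while⇓ zs [] Pzs [] (subst (_≤ K) (sym (+-identityʳ (length zs))) len)
    ... | t , w , p =
      letᴱ (consᴱ d d′)
           (tlᴱ (t , w , ≤-trans p (*-monoˡ-≤ (suc (timeBound K cond + timeBound K body)) (s≤s len))))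

  ⊤ₚ : {A : Set} → A → Set
  ⊤ₚ _ = ⊤

  all⊤ : {A : Set} (xs : List A) → All ⊤ₚ xs
  all⊤ = All.universal (λ _ → tt)

  foldr-∷ : ∀ {A : Set} (xs ys : List A) → foldr _∷_ ys xs ≡ xs ++ ys
  foldr-∷ []       ys = refl
  foldr-∷ (x ∷ xs) ys = cong (x ∷_) (foldr-∷ xs ys)

  module _ {A : Set} (encA : A → Value) {ρ : Vec Value n} {l : Exp n} where

    reverseᴱ : ∀ xs → length xs ≤ K → ρ ⊢ l ↓ encodeList-map encA xs →
               ρ ⊢ reverseᴾ l ↓ encodeList-map encA (reverse xs)
    reverseᴱ xs len d =
      subst↓ (cong (encodeList-map encA) (trans (foldr-∷ (reverse xs) []) (++-identityʳ (reverse xs))))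
        (loopᴱ encA (encodeList-map encA) ⊤ₚ (λ _ _ _ _ _ _ → consᴱ (varᴱ (# 1)) (varᴱ (# 0)))
               xs (all⊤ xs) len d nilᴱ)

    foldrᴱ : {B : Set} (encB : B → Value) (P : A → Set) {f : A → B → B} {i : B}
             {b : Exp (suc (suc (suc n)))} {j : Exp n} →
             ∀ xs → All P xs → length xs ≤ K →
             (∀ x ys s → P x → All P ys → length ys < K →
              (encB (foldr f i ys) ∷ encA x ∷ s ∷ ρ) ⊢ b ↓ encB (f x (foldr f i ys))) →
             ρ ⊢ l ↓ encodeList-map encA xs → ρ ⊢ j ↓ encB i →
             ρ ⊢ foldrᴾ b l j ↓ encB (foldr f i xs)
    foldrᴱ encB P {f} {i} xs Pxs len step d d′ =
      subst↓ (cong (encB ∘ foldr f i) (reverse-involutive xs))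
        (loopᴱ encA encB P step (reverse xs) (All-resp-↭ (↭-sym (↭-reverse xs)) Pxs)
               (subst (_≤ K) (sym (length-reverse xs)) len) (reverseᴱ xs len d) d′)

    filterᴱ : {P : A → Set} (P? : Decidable P) (Q : A → Set) {p : Exp (suc (suc (suc n)))} →
              ∀ xs → All Q xs → length xs ≤ K →
              (∀ x v s → Q x → (v ∷ encA x ∷ s ∷ ρ) ⊢ p ↓ encodeBool (P? x)) →
              ρ ⊢ l ↓ encodeList-map encA xs →
              ρ ⊢ filterᴾ p l ↓ encodeList-map encA (filter P? xs)
    filterᴱ P? Q xs Qxs len pᴱ d =
      subst↓ (cong (encodeList-map encA) (foldr-filter xs))
        (foldrᴱ (encodeList-map encA) Q {f = keep} {i = []} xs Qxs len
          (λ x ys s Qx _ _ → subst↓ (if-enc (does (P? x)) x _)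
             (ifᴱ (does (P? x)) (pᴱ x _ s Qx) (consᴱ (varᴱ (# 1)) (varᴱ (# 0))) (varᴱ (# 0))))
          d nilᴱ)
      where
      keep : A → List A → List A
      keep x acc = if does (P? x) then x ∷ acc else acc
      if-enc : ∀ b x acc → (if b then cons (encA x) (encodeList-map encA acc) else encodeList-map encA acc)
               ≡ encodeList-map encA (if b then x ∷ acc else acc)
      if-enc true  x acc = refl
      if-enc false x acc = refl
      foldr-filter : ∀ xs → foldr keep [] xs ≡ filter P? xs
      foldr-filter [] = refl
      foldr-filter (x ∷ xs) with does (P? x)
      ... | true  = cong (x ∷_) (foldr-filter xs)
      ... | false = foldr-filter xs

    ++ᴱ : ∀ {r} xs ys → length xs ≤ K →
          ρ ⊢ l ↓ encodeList-map encA xs → ρ ⊢ r ↓ encodeList-map encA ys →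
          ρ ⊢ l ++ᴾ r ↓ encodeList-map encA (xs ++ ys)
    ++ᴱ xs ys len d d′ =
      subst↓ (cong (encodeList-map encA) (foldr-∷ xs ys))
        (foldrᴱ (encodeList-map encA) ⊤ₚ xs (all⊤ xs) len
          (λ _ _ _ _ _ _ → consᴱ (varᴱ (# 1)) (varᴱ (# 0))) d d′)

    lengthᴱ : ∀ xs → length xs ≤ K → ρ ⊢ l ↓ encodeList-map encA xs →
              ρ ⊢ lengthᴾ l ↓ encodeℕ (length xs)
    lengthᴱ xs len d =
      foldrᴱ encodeℕ ⊤ₚ xs (all⊤ xs) len
        (λ _ ys _ _ _ _ → addℕᴱ 1 (length ys) (numᴱ _) (varᴱ (# 0))) d (numᴱ _)

-- Sums over lists and their filters

if-elim : {A P : Set} (C : A → Set) (P? : Dec P) {x y : A} → (P → C x) → (¬ P → C y) →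
          C (if does P? then x else y)
if-elim C (yes p) f g = f p
if-elim C (no ¬p) f g = g ¬p

-- Totals, masses, occurrences and numbers of idle machines are all of this form, and
-- `sumBy (const 1)` is definitionally `length`, so one lemma on filters serves them all.
sumBy : {A : Set} → (A → ℕ) → List A → ℕ
sumBy w = foldr (λ x k → w x + k) 0

indicator : {P : Set} → Dec P → ℕ
indicator P? = if does P? then 1 else 0

indicator-yes : {P : Set} (P? : Dec P) → P → indicator P? ≡ 1
indicator-yes (yes _) p = refl
indicator-yes (no ¬p) p = contradiction p ¬p

indicator-no : {P : Set} (P? : Dec P) → ¬ P → indicator P? ≡ 0
indicator-no (yes p) ¬p = contradiction p ¬p
indicator-no (no _)  ¬p = refl

indicator≤1 : {P : Set} (P? : Dec P) → indicator P? ≤ 1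
indicator≤1 (yes _) = ≤-refl
indicator≤1 (no _)  = z≤n

indicator-mono : {P Q : Set} (P? : Dec P) (Q? : Dec Q) → (P → Q) → indicator P? ≤ indicator Q?
indicator-mono (yes p) Q? f = ≤-reflexive (sym (indicator-yes Q? (f p)))
indicator-mono (no _)  Q? f = z≤n

module _ {A : Set} (w : A → ℕ) where

  sumBy-++ : ∀ xs ys → sumBy w (xs ++ ys) ≡ sumBy w xs + sumBy w ys
  sumBy-++ []       ys = refl
  sumBy-++ (x ∷ xs) ys = trans (cong (w x +_) (sumBy-++ xs ys)) (sym (+-assoc (w x) _ _))

  sumBy-mono : ∀ {w′ : A → ℕ} {xs} → All (λ x → w x ≤ w′ x) xs → sumBy w xs ≤ sumBy w′ xs
  sumBy-mono []       = z≤n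
  sumBy-mono (p ∷ ps) = +-mono-≤ p (sumBy-mono ps)

  sumBy-cover : ∀ {P Q : A → Set} (P? : Decidable P) (Q? : Decidable Q) → (∀ x → P x ⊎ Q x) →
                ∀ xs → sumBy w xs ≤ sumBy w (filter P? xs) + sumBy w (filter Q? xs)
  sumBy-cover P? Q? cov [] = z≤n
  sumBy-cover P? Q? cov (x ∷ xs) with P? x | Q? x | sumBy-cover P? Q? cov xs
  ... | yes _ | yes _ | ih = ≤-trans (+-monoʳ-≤ (w x) ih)
          (≤-trans (≤-reflexive (sym (+-assoc (w x) _ _))) (+-monoʳ-≤ (w x + sumBy w (filter P? xs)) (m≤n+m _ (w x))))
  ... | yes _ | no _  | ih = ≤-trans (+-monoʳ-≤ (w x) ih) (≤-reflexive (sym (+-assoc (w x) _ _)))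
  ... | no _  | yes _ | ih = ≤-trans (+-monoʳ-≤ (w x) ih)
          (≤-reflexive (solve 3 (λ a b c → a :+ (b :+ c) := b :+ (a :+ c)) refl (w x) (sumBy w (filter P? xs)) _))
          where open +-*-Solver
  ... | no ¬p | no ¬q | _ with cov x
  ...   | inj₁ p = contradiction p ¬p
  ...   | inj₂ q = contradiction q ¬q

  sumBy-exclusive : ∀ {P Q : A → Set} (P? : Decidable P) (Q? : Decidable Q) → (∀ x → P x → ¬ Q x) →
                    ∀ xs → sumBy w (filter P? xs) + sumBy w (filter Q? xs) ≤ sumBy w xs
  sumBy-exclusive P? Q? exc [] = z≤n
  sumBy-exclusive P? Q? exc (x ∷ xs) with P? x | Q? x | sumBy-exclusive P? Q? exc xs
  ... | yes p | yes q | _  = contradiction q (exc x p)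
  ... | yes _ | no _  | ih = ≤-trans (≤-reflexive (+-assoc (w x) _ _)) (+-monoʳ-≤ (w x) ih)
  ... | no _  | yes _ | ih = ≤-trans
          (≤-reflexive (solve 3 (λ a b c → b :+ (a :+ c) := a :+ (b :+ c)) refl (w x) (sumBy w (filter P? xs)) _))
          (+-monoʳ-≤ (w x) ih)
          where open +-*-Solver
  ... | no _  | no _  | ih = ≤-trans ih (m≤n+m _ (w x))

  sumBy-split : ∀ {P : A → Set} (P? : Decidable P) xs →
                sumBy w (filter P? xs) + sumBy w (filter (¬? ∘ P?) xs) ≡ sumBy w xs
  sumBy-split P? xs = ≤-antisym (sumBy-exclusive P? (¬? ∘ P?) (λ _ p ¬p → ¬p p) xs)
                                (sumBy-cover P? (¬? ∘ P?) cov xs)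
    where
    cov : ∀ x → _ ⊎ _
    cov x with P? x
    ... | yes p = inj₁ p
    ... | no ¬p = inj₂ ¬p

  sumBy≤length* : ∀ {b xs} → All (λ x → w x ≤ b) xs → sumBy w xs ≤ length xs * b
  sumBy≤length* []       = z≤n
  sumBy≤length* (p ∷ ps) = +-mono-≤ p (sumBy≤length* ps)

  length*≤sumBy : ∀ {b xs} → All (λ x → b ≤ w x) xs → length xs * b ≤ sumBy w xs
  length*≤sumBy []       = z≤n
  length*≤sumBy (p ∷ ps) = +-mono-≤ p (length*≤sumBy ps)

  sumBy-each : ∀ {b} xs → sumBy w xs ≤ b → All (λ x → w x ≤ b) xs
  sumBy-each []       _ = []
  sumBy-each (x ∷ xs) p = ≤-trans (m≤m+n (w x) _) p ∷ sumBy-each xs (≤-trans (m≤n+m _ (w x)) p)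

module _ {A : Set} {P : A → Set} (P? : Decidable P) where

  all-filter⁻ : ∀ {Q : A → Set} xs → All Q (filter P? xs) → All (λ x → P x → Q x) xs
  all-filter⁻ [] _ = []
  all-filter⁻ (x ∷ xs) qs with P? x
  all-filter⁻ (x ∷ xs) (q ∷ qs) | yes _ = (λ _ → q) ∷ all-filter⁻ xs qs
  ... | no ¬p = (λ p → contradiction p ¬p) ∷ all-filter⁻ xs qs

  indicator-none : ∀ xs → filter P? xs ≡ [] → sumBy (λ x → indicator (P? x)) xs ≡ 0
  indicator-none []       _ = refl
  indicator-none (x ∷ xs) eq with P? x
  ... | no _ = indicator-none xs eq

≰⇒≥ℚ : ∀ {p q} → ¬ (p ℚ.≤ q) → q ℚ.≤ p
≰⇒≥ℚ = ℚₚ.<⇒≤ ∘ ℚₚ.≰⇒>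

<⇒≱ℚ : ∀ {p q} → p ℚ.< q → ¬ (q ℚ.≤ p)
<⇒≱ℚ p<q q≤p = ℚₚ.<-irrefl refl (ℚₚ.<-≤-trans p<q q≤p)

-- The algorithm on lists of chains

module Algorithm {n : ℕ} (I : Instance n) where

  startOf endOf : Fin n → ℚ
  startOf j = start (lookup I j)
  endOf j = end (lookup I j)

  -- The intervals of one machine, the latest first.
  Chain : Set
  Chain = List (Fin n)

  lastEnd : Chain → ℚ
  lastEnd []      = 0ℚ
  lastEnd (j ∷ _) = endOf j

  insert : Fin n → Chain → Chain
  insert j js = filter (λ k → ¬? (endOf k ℚₚ.≤? endOf j)) js ++ j ∷ filter (λ k → endOf k ℚₚ.≤? endOf j) js

  sort : Chain → Chain
  sort = foldr insert []

  -- The chains are kept by decreasing `lastEnd`. Hence the head of those that fit is the one that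
  -- became idle last, and the chain extended by `j`, which ends last so far, belongs in front.
  placeIn : Fin n → List Chain → List Chain → List Chain
  placeIn j cs []        = cs
  placeIn j cs (c ∷ fit) = (j ∷ c) ∷ filter (λ d → ¬? (lastEnd d ℚₚ.≤? startOf j)) cs ++ fit

  place : Fin n → List Chain → List Chain
  place j cs = placeIn j cs (filter (λ d → lastEnd d ℚₚ.≤? startOf j) cs)

  -- Bounded by `n` rounds because `m` may be exponential in the input; the result has `m ⊓ n`
  -- chains.
  emptyChains : ℕ → List Chain
  emptyChains m = foldr (λ _ cs → if does (suc (length cs) ≤? m) then [] ∷ cs else cs) [] (allFin n)

  -- `sort` puts the latest end first, so the right fold places the earliest end first.
  greedy : ℕ → List Chain
  greedy m = foldr place (emptyChains m) (sort (allFin n))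

  total : List Chain → ℕ
  total = sumBy length

  -- Division by trial: the value rises while it is still at most the quotient. For a nonempty list
  -- with total at most `n`, `n` trials suffice.
  average : List Chain → ℕ
  average cs = foldr (λ _ τ → if does (length cs * suc τ ≤? total cs) then suc τ else τ) 0 (allFin n)

  after before : ℚ → Chain → Chain
  after t  = filter (λ j → t ℚₚ.≤? startOf j)
  before t = filter (λ j → endOf j ℚₚ.≤? t)

  -- The load of a machine that follows `b` to its last interval and `a` from then on. Here `b`
  -- stands for a suffix of the list, that is, for an early part of the machine.
  cutSize : Chain → Chain → ℕ
  cutSize a b = length b + length (after (lastEnd b) a)

  -- One round per interval of `b` is enough: once all are dropped, the time is `0` and the size is
  -- the load of `a`.
  cutPoint : ℕ → Chain → Chain → Chain
  cutPoint τ a b = foldr (λ _ b′ → if does (cutSize a b′ ≤? τ) then b′ else drop 1 b′) b b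

  -- The first component is the machine to be fixed, the second goes back to the remaining ones.
  cut : ℕ → Chain → Chain → Chain × Chain
  cut τ a b = if does (τ ≤? length a) then (a , b) else
    (let b′ = cutPoint τ a b in after (lastEnd b′) a ++ b′ , after (lastEnd b′) b ++ before (lastEnd b′) a)

  -- Remaining chains, then fixed chains.
  State : Set
  State = List Chain × List Chain

  -- The chains of load at most `τ` and those above it are arguments so that proofs can split on
  -- them.
  stepWith : ℕ → State → List Chain → List Chain → State
  stepWith τ s []       _        = s
  stepWith τ s (a ∷ lo) []       = s
  stepWith τ s (a ∷ lo) (b ∷ hi) = proj₂ (cut τ a b) ∷ lo ++ hi , proj₁ (cut τ a b) ∷ proj₂ s

  step : State → State
  step s = stepWith τ s (filter (λ c → length c ≤? τ) (proj₁ s)) (filter (λ c → suc τ ≤? length c) (proj₁ s))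
    where τ = average (proj₁ s)

  balance : List Chain → List Chain
  balance cs = let s = foldr (λ _ → step) (cs , []) cs in proj₁ s ++ proj₂ s

  -- With more machines than intervals, machines outside the capped list would stay empty, and any
  -- load above one would violate EF1. One interval per machine avoids this and loses nothing.
  chains : ℕ → List Chain
  chains m = if does (n ≤? m) then map [_] (allFin n) else balance (greedy m)

  -- An inequality of masses for all `w` says that no interval occurs more often than before. The
  -- weight `is j` below singles out one interval, and `one` gives the total load.
  mass : (Fin n → ℕ) → List Chain → ℕ
  mass w = sumBy (sumBy w)

  one : Fin n → ℕ
  one _ = 1

  _≽_ : Fin n → Fin n → Set
  j ≽ k = endOf k ℚ.≤ endOf j

  -- What sorting and placing preserve

  sumBy-insert : ∀ w j js → sumBy w (insert j js) ≡ w j + sumBy w js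
  sumBy-insert w j js = begin
    sumBy w (filter Q? js ++ j ∷ filter P? js)                ≡⟨ sumBy-++ w (filter Q? js) _ ⟩
    sumBy w (filter Q? js) + (w j + sumBy w (filter P? js))
      ≡⟨ solve 3 (λ a b c → a :+ (b :+ c) := b :+ (c :+ a)) refl (sumBy w (filter Q? js)) (w j) _ ⟩
    w j + (sumBy w (filter P? js) + sumBy w (filter Q? js))   ≡⟨ cong (w j +_) (sumBy-split w P? js) ⟩
    w j + sumBy w js ∎
    where
    P? = λ k → endOf k ℚₚ.≤? endOf j
    Q? = ¬? ∘ P?
    open +-*-Solver
    open ≡-Reasoning

  sumBy-sort : ∀ w js → sumBy w (sort js) ≡ sumBy w js
  sumBy-sort w []       = refl
  sumBy-sort w (j ∷ js) = trans (sumBy-insert w j (sort js)) (cong (w j +_) (sumBy-sort w js))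

  sort-sorted : ∀ js → AllPairs _≽_ (sort js)
  sort-sorted []       = []
  sort-sorted (j ∷ js) = AllPairsₚ.++⁺ (AllPairsₚ.filter⁺ Q? ih)
    (Allₚ.all-filter P? (sort js) ∷ AllPairsₚ.filter⁺ P? ih)
    (All.map (λ k≰j → ≰⇒≥ℚ k≰j ∷ All.map (λ l≤j → ℚₚ.≤-trans l≤j (≰⇒≥ℚ k≰j)) (Allₚ.all-filter P? (sort js)))
             (Allₚ.all-filter Q? (sort js)))
    where
    P? = λ k → endOf k ℚₚ.≤? endOf j
    Q? = ¬? ∘ P?
    ih = sort-sorted js

  Before : Fin n → Fin n → Set
  Before j k = endOf k ℚ.≤ startOf j

  Valid : Chain → Set
  Valid = AllPairs Before

  start<endOf : ∀ j → startOf j ℚ.< endOf j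
  start<endOf j = start<end (lookup I j)

  0≤start : ∀ j → 0ℚ ℚ.≤ startOf j
  0≤start j = nonNegative (lookup I j)

  ByEnd : Chain → Chain → Set
  ByEnd c d = lastEnd d ℚ.≤ lastEnd c

  -- Placing only replaces `c` by `j ∷ c` and permutes the list; adding `f c` on the left avoids
  -- subtraction. Instances of `f` count machines, mass and idle machines.
  place-sumBy : ∀ (f : Chain → ℕ) j cs {c fit} → filter (λ d → lastEnd d ℚₚ.≤? startOf j) cs ≡ c ∷ fit →
                f c + sumBy f (placeIn j cs (c ∷ fit)) ≡ f (j ∷ c) + sumBy f cs
  place-sumBy f j cs {c} {fit} eq = begin
    f c + (f (j ∷ c) + sumBy f (rest ++ fit))        ≡⟨ cong (λ k → f c + (f (j ∷ c) + k)) (sumBy-++ f rest fit) ⟩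
    f c + (f (j ∷ c) + (sumBy f rest + sumBy f fit))
      ≡⟨ solve 4 (λ a b r s → a :+ (b :+ (r :+ s)) := b :+ (a :+ s :+ r)) refl (f c) (f (j ∷ c)) (sumBy f rest) (sumBy f fit) ⟩
    f (j ∷ c) + (sumBy f (c ∷ fit) + sumBy f rest)   ≡⟨ cong (λ ds → f (j ∷ c) + (sumBy f ds + sumBy f rest)) (sym eq) ⟩
    f (j ∷ c) + (sumBy f (filter fit? cs) + sumBy f rest)  ≡⟨ cong (f (j ∷ c) +_) (sumBy-split f fit? cs) ⟩
    f (j ∷ c) + sumBy f cs ∎
    where
    fit? = λ d → lastEnd d ℚₚ.≤? startOf j
    rest = filter (¬? ∘ fit?) cs
    open +-*-Solver
    open ≡-Reasoning

  placed-mass : ∀ w j cs {c fit} → filter (λ d → lastEnd d ℚₚ.≤? startOf j) cs ≡ c ∷ fit →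
                mass w (placeIn j cs (c ∷ fit)) ≡ w j + mass w cs
  placed-mass w j cs {c} eq = +-cancelˡ-≡ (sumBy w c) _ _
    (trans (place-sumBy (sumBy w) j cs eq)
           (solve 3 (λ a b r → a :+ b :+ r := b :+ (a :+ r)) refl (w j) (sumBy w c) (mass w cs)))
    where open +-*-Solver

  place-mass : ∀ w j cs → mass w (place j cs) ≤ w j + mass w cs
  place-mass w j cs with filter (λ d → lastEnd d ℚₚ.≤? startOf j) cs in eq
  ... | []      = m≤n+m _ (w j)
  ... | c ∷ fit = ≤-reflexive (placed-mass w j cs eq)

  length-place : ∀ j cs → length (place j cs) ≡ length cs
  length-place j cs with filter (λ d → lastEnd d ℚₚ.≤? startOf j) cs in eq
  ... | []      = refl
  ... | c ∷ fit = suc-injective (place-sumBy (const 1) j cs eq)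

-- Optimality of the greedy schedule

sum-mono : ∀ {m} {f g : Fin m → ℕ} → (∀ i → f i ≤ g i) → sum f ≤ sum g
sum-mono {zero}  f≤g = z≤n
sum-mono {suc m} f≤g = +-mono-≤ (f≤g zero) (sum-mono (f≤g ∘ suc))

sum-≤1 : ∀ {m} {f : Fin m → ℕ} → (∀ i → f i ≤ 1) → sum f ≤ m
sum-≤1 {zero}  f≤1 = z≤n
sum-≤1 {suc m} f≤1 = +-mono-≤ (f≤1 zero) (sum-≤1 (f≤1 ∘ suc))

sum-mono-< : ∀ {m} {f g : Fin m → ℕ} → (∀ i → f i ≤ g i) → ∀ i → f i < g i → sum f < sum g
sum-mono-< {suc m} {f} {g} f≤g i fi<gi = begin-strict
  sum f                                          ≡⟨ sum-remove f ⟩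
  f i + sum (λ k → f (Fin.punchIn i k))          <⟨ +-mono-<-≤ fi<gi (sum-mono (λ k → f≤g (Fin.punchIn i k))) ⟩
  g i + sum (λ k → g (Fin.punchIn i k))          ≡⟨ sym (sum-remove g) ⟩
  sum g ∎
  where open ≤-Reasoning

sum-swap : ∀ {m} {f g : Fin m → ℕ} i → (∀ k → k ≢ i → g k ≡ f k) → g i + sum f ≡ f i + sum g
sum-swap {suc m} {f} {g} i eq = begin
  g i + sum f                                     ≡⟨ cong (g i +_) (sum-remove f) ⟩
  g i + (f i + sum (λ k → f (Fin.punchIn i k)))
    ≡⟨ cong (λ r → g i + (f i + r)) (sum-cong-≗ (λ k → sym (eq (Fin.punchIn i k) (Finₚ.punchInᵢ≢i i k)))) ⟩
  g i + (f i + sum (λ k → g (Fin.punchIn i k)))   ≡⟨ solve 3 (λ a b c → a :+ (b :+ c) := b :+ (a :+ c)) refl (g i) (f i) _ ⟩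
  f i + (g i + sum (λ k → g (Fin.punchIn i k)))   ≡⟨ cong (f i +_) (sym (sum-remove g)) ⟩
  f i + sum g ∎
  where
  open +-*-Solver
  open ≡-Reasoning

module GreedyOptimality {n : ℕ} (I : Instance n) where

  open Algorithm I

  valid⇒ended : ∀ {c} → Valid c → All (λ k → endOf k ℚ.≤ lastEnd c) c
  valid⇒ended []        = []
  valid⇒ended (bs ∷ _) = ℚₚ.≤-refl ∷ All.map (λ {k} b → ℚₚ.≤-trans b (ℚₚ.<⇒≤ (start<endOf _))) bs

  place-valid : ∀ j cs → All Valid cs → All Valid (place j cs)
  place-valid j cs vs with filter (λ d → lastEnd d ℚₚ.≤? startOf j) cs
                         | Allₚ.filter⁺ (λ d → lastEnd d ℚₚ.≤? startOf j) vs
                         | Allₚ.all-filter (λ d → lastEnd d ℚₚ.≤? startOf j) cs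
  ... | []      | _       | _       = vs
  ... | c ∷ fit | v ∷ vs′ | c≤j ∷ _ =
    (All.map (λ e → ℚₚ.≤-trans e c≤j) (valid⇒ended v) ∷ v) ∷
    Allₚ.++⁺ (Allₚ.filter⁺ (λ d → ¬? (lastEnd d ℚₚ.≤? startOf j)) vs) vs′

  place-ended : ∀ {t} j cs → endOf j ℚ.≤ t → All (λ c → lastEnd c ℚ.≤ t) cs →
                All (λ c → lastEnd c ℚ.≤ t) (place j cs)
  place-ended j cs j≤t es with filter (λ d → lastEnd d ℚₚ.≤? startOf j) cs
                             | Allₚ.filter⁺ (λ d → lastEnd d ℚₚ.≤? startOf j) es
  ... | []      | _       = es
  ... | c ∷ fit | _ ∷ es′ = j≤t ∷ Allₚ.++⁺ (Allₚ.filter⁺ (λ d → ¬? (lastEnd d ℚₚ.≤? startOf j)) es) es′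

  place-sorted : ∀ j cs → All (λ c → lastEnd c ℚ.≤ endOf j) cs → AllPairs ByEnd cs →
                 AllPairs ByEnd (place j cs)
  place-sorted j cs es ss with filter (λ d → lastEnd d ℚₚ.≤? startOf j) cs
                             | Allₚ.filter⁺ (λ d → lastEnd d ℚₚ.≤? startOf j) es
                             | AllPairsₚ.filter⁺ (λ d → lastEnd d ℚₚ.≤? startOf j) ss
                             | Allₚ.all-filter (λ d → lastEnd d ℚₚ.≤? startOf j) cs
  ... | []      | _       | _       | _        = ss
  ... | c ∷ fit | _ ∷ es′ | _ ∷ ss′ | _ ∷ fit≤ =
    Allₚ.++⁺ (Allₚ.filter⁺ Q? es) es′ ∷
    AllPairsₚ.++⁺ (AllPairsₚ.filter⁺ Q? ss) ss′
      (All.map (λ d≰j → All.map (λ f≤j → ℚₚ.≤-trans f≤j (≰⇒≥ℚ d≰j)) fit≤) (Allₚ.all-filter Q? cs))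
    where Q? = λ d → ¬? (lastEnd d ℚₚ.≤? startOf j)

  module _ (m : ℕ) where

    run : Chain → List Chain
    run = foldr place (replicate m [])

    run-length : ∀ js → length (run js) ≡ m
    run-length []       = length-replicate m
    run-length (j ∷ js) = trans (length-place j (run js)) (run-length js)

    run-valid : ∀ js → All Valid (run js)
    run-valid []       = Allₚ.replicate⁺ m []
    run-valid (j ∷ js) = place-valid j (run js) (run-valid js)

    run-ended : ∀ {t} js → 0ℚ ℚ.≤ t → All (λ j → endOf j ℚ.≤ t) js → All (λ c → lastEnd c ℚ.≤ t) (run js)
    run-ended []       0≤t _          = Allₚ.replicate⁺ m 0≤t
    run-ended (j ∷ js) 0≤t (e ∷ es) = place-ended j (run js) e (run-ended js 0≤t es)

    0≤end : ∀ j → 0ℚ ℚ.≤ endOf j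
    0≤end j = ℚₚ.≤-trans (0≤start j) (ℚₚ.<⇒≤ (start<endOf j))

    replicate-sorted : ∀ k → AllPairs ByEnd (replicate k [])
    replicate-sorted zero    = []
    replicate-sorted (suc k) = Allₚ.replicate⁺ k ℚₚ.≤-refl ∷ replicate-sorted k

    run-sorted : ∀ {js} → AllPairs _≽_ js → AllPairs ByEnd (run js)
    run-sorted {[]}     []       = replicate-sorted m
    run-sorted {j ∷ js} (p ∷ ps) = place-sorted j (run js) (run-ended js (0≤end j) p) (run-sorted ps)

    module _ (d : Fin n → Maybe (Fin m)) where

      assign : Maybe (Fin m) → ℚ → (Fin m → ℚ) → Fin m → ℚ
      assign nothing  e E = E
      assign (just i) e E k = if does (k Fin.≟ i) then e else E k

      lastEnds : Chain → Fin m → ℚ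
      lastEnds = foldr (λ j → assign (d j) (endOf j)) (const 0ℚ)

      -- The tail `js` holds the intervals processed before `j`, so the other schedule is built up
      -- in the same order as the greedy one.
      data Feasible : Chain → Set where
        []  : Feasible []
        _∷_ : ∀ {j js} → (∀ i → d j ≡ just i → lastEnds js i ℚ.≤ startOf j) →
              Feasible js → Feasible (j ∷ js)

      accepted : Fin n → ℕ
      accepted j = if is-just (d j) then 1 else 0

      freeBy : ℚ → Chain → ℕ
      freeBy t c = indicator (lastEnd c ℚₚ.≤? t)

      idle : ℚ → List Chain → ℕ
      idle t = sumBy (freeBy t)

      idle′ : ℚ → (Fin m → ℚ) → ℕ
      idle′ t E = sum (λ i → indicator (E i ℚₚ.≤? t))

      idle-all : ∀ t {cs} → All (λ c → lastEnd c ℚ.≤ t) cs → idle t cs ≡ length cs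
      idle-all t []       = refl
      idle-all t {c ∷ cs} (p ∷ ps) = cong₂ _+_ (indicator-yes (lastEnd c ℚₚ.≤? t) p) (idle-all t ps)

      idle-none : ∀ t {cs} → filter (λ c → lastEnd c ℚₚ.≤? t) cs ≡ [] → idle t cs ≡ 0
      idle-none t {cs} = indicator-none (λ c → lastEnd c ℚₚ.≤? t) cs

      idle′≤m : ∀ t E → idle′ t E ≤ m
      idle′≤m t E = sum-≤1 (λ i → indicator≤1 (E i ℚₚ.≤? t))

      -- After the update machine `i` is busy at `t`, and no other machine changes; the indicator
      -- records whether it was idle before.
      idle′-update-late : ∀ {t e} E i → t ℚ.< e →
                          indicator (E i ℚₚ.≤? t) + idle′ t (assign (just i) e E) ≡ idle′ t E
      idle′-update-late {t} {e} E i t<e = sym (trans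
        (cong (_+ idle′ t E) (sym busy)) (sum-swap i other))
        where
        F = assign (just i) e E
        Fi≡e : F i ≡ e
        Fi≡e with i Fin.≟ i
        ... | yes _  = refl
        ... | no i≢i = contradiction refl i≢i
        busy : indicator (F i ℚₚ.≤? t) ≡ 0
        busy = indicator-no (F i ℚₚ.≤? t) (λ Fi≤t → <⇒≱ℚ t<e (subst (ℚ._≤ t) Fi≡e Fi≤t))
        other : ∀ k → k ≢ i → indicator (F k ℚₚ.≤? t) ≡ indicator (E k ℚₚ.≤? t)
        other k k≢i with k Fin.≟ i
        ... | yes k≡i = contradiction k≡i k≢i
        ... | no _    = refl

      idle′-update-released : ∀ {t e} E i → t ℚ.< e → E i ℚ.≤ t →
                              suc (idle′ t (assign (just i) e E)) ≡ idle′ t E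
      idle′-update-released {t} {e} E i t<e Ei≤t =
        trans (cong (_+ idle′ t (assign (just i) e E)) (sym (indicator-yes (E i ℚₚ.≤? t) Ei≤t))) (idle′-update-late E i t<e)

      idle′-update-busy : ∀ {t e} E i → t ℚ.< e → ¬ (E i ℚ.≤ t) →
                          idle′ t (assign (just i) e E) ≡ idle′ t E
      idle′-update-busy {t} {e} E i t<e Ei≰t =
        trans (cong (_+ idle′ t (assign (just i) e E)) (sym (indicator-no (E i ℚₚ.≤? t) Ei≰t))) (idle′-update-late E i t<e)

      idle′-mono-< : ∀ {s t} E i → t ℚ.≤ s → E i ℚ.≤ s → ¬ (E i ℚ.≤ t) → suc (idle′ t E) ≤ idle′ s E
      idle′-mono-< {s} {t} E i t≤s Ei≤s Ei≰t = sum-mono-<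
        (λ k → indicator-mono (E k ℚₚ.≤? t) (E k ℚₚ.≤? s) (λ p → ℚₚ.≤-trans p t≤s)) i
        (subst₂ _<_ (sym (indicator-no (E i ℚₚ.≤? t) Ei≰t)) (sym (indicator-yes (E i ℚₚ.≤? s) Ei≤s)) ≤-refl)

      idle′-pos : ∀ {s} E i → E i ℚ.≤ s → 1 ≤ idle′ s E
      idle′-pos {s} E i Ei≤s = ≤-trans (s≤s z≤n)
        (sum-mono-< {f = λ _ → 0} (λ _ → z≤n) i (≤-reflexive (sym (indicator-yes (E i ℚₚ.≤? s) Ei≤s))))

      module _ (j : Fin n) (cs : List Chain) (E : Fin m → ℚ) (k : ℕ)
               (len : length cs ≡ m)
               (ended : All (λ c → lastEnd c ℚ.≤ endOf j) cs)
               (sorted : AllPairs ByEnd cs)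
               (lag : ∀ t → idle′ t E ≤ idle t cs + k) where

        private
          fit? : Decidable (λ c → lastEnd c ℚ.≤ startOf j)
          fit? c = lastEnd c ℚₚ.≤? startOf j

        -- From the end of `j` on, all greedy machines are idle, since nothing placed so far ends
        -- later. So only earlier times need an argument, and there `j` makes its machine busy.
        lag-split : ∀ {cs′ k′} F → length cs′ ≡ m → All (λ c → lastEnd c ℚ.≤ endOf j) cs′ →
                    (∀ t → t ℚ.< endOf j → idle′ t F ≤ idle t cs′ + k′) →
                    ∀ t → idle′ t F ≤ idle t cs′ + k′
        lag-split {cs′} {k′} F len′ ended′ early t with endOf j ℚₚ.≤? t
        ... | no ¬p  = early t (ℚₚ.≰⇒> ¬p)
        ... | yes e≤t = begin
          idle′ t F          ≤⟨ idle′≤m t F ⟩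
          m                  ≡⟨ sym len′ ⟩
          length cs′         ≡⟨ sym (idle-all t (All.map (λ p → ℚₚ.≤-trans p e≤t) ended′)) ⟩
          idle t cs′         ≤⟨ m≤m+n _ k′ ⟩
          idle t cs′ + k′    ∎
          where open ≤-Reasoning

        idle-placed : ∀ {c fit} → filter fit? cs ≡ c ∷ fit → ∀ t → t ℚ.< endOf j →
                      freeBy t c + idle t (placeIn j cs (c ∷ fit)) ≡ idle t cs
        idle-placed {c} eq t t<e = trans (place-sumBy (freeBy t) j cs eq)
          (cong (_+ idle t cs) (indicator-no (endOf j ℚₚ.≤? t) (<⇒≱ℚ t<e)))

        idle-placed-busy : ∀ {c fit} → filter fit? cs ≡ c ∷ fit → ∀ t → t ℚ.< endOf j → ¬ (lastEnd c ℚ.≤ t) →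
                           idle t (placeIn j cs (c ∷ fit)) ≡ idle t cs
        idle-placed-busy {c} {fit} eq t t<e c≰t =
          trans (cong (_+ idle t (placeIn j cs (c ∷ fit))) (sym (indicator-no (lastEnd c ℚₚ.≤? t) c≰t))) (idle-placed eq t t<e)

        -- Best fit: the chain c extended by j ends last among those that fit,
        -- so if c is idle at t then every chain idle at the start of j is.
        idle-best-fit : ∀ {c fit} → filter fit? cs ≡ c ∷ fit → ∀ t → lastEnd c ℚ.≤ t → idle (startOf j) cs ≤ idle t cs
        idle-best-fit {c} eq t c≤t = sumBy-mono (freeBy (startOf j))
          (All.map (λ {x} le → indicator-mono (fit? x) (lastEnd x ℚₚ.≤? t) le)
            (all-filter⁻ fit? cs (subst (All (λ x → lastEnd x ℚ.≤ t)) (sym eq) (best (subst (AllPairs ByEnd) eq (AllPairsₚ.filter⁺ fit? sorted))))))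
          where
          best : ∀ {fit} → AllPairs ByEnd (c ∷ fit) → All (λ x → lastEnd x ℚ.≤ t) (c ∷ fit)
          best (b ∷ _) = c≤t ∷ All.map (λ p → ℚₚ.≤-trans p c≤t) b

        -- Machine `i` becomes idle after `t` and no later than the start of `j`, so it is counted
        -- at the start of `j` in addition to all machines counted at `t`.
        released-between : ∀ t i → E i ℚ.≤ startOf j → ¬ (E i ℚ.≤ t) → suc (idle′ t E) ≤ idle (startOf j) cs + k
        released-between t i Ei≤s Ei≰t =
          ≤-trans (idle′-mono-< E i (ℚₚ.<⇒≤ (ℚₚ.<-≤-trans (ℚₚ.≰⇒> Ei≰t) Ei≤s)) Ei≤s Ei≰t) (lag (startOf j))

        -- The lead drops by one, and the other schedule must pay for it. If machine `i` was idle at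
        -- `t`, it no longer is. Otherwise it is released between `t` and the start of `j`, where
        -- the greedy schedule has no idle machine, so the lead alone exceeds the idle machines at
        -- `t`.
        early-reject : ∀ {k′} i → E i ℚ.≤ startOf j → filter fit? cs ≡ [] → k ≡ suc k′ →
                       ∀ t → t ℚ.< endOf j → idle′ t (assign (just i) (endOf j) E) ≤ idle t cs + k′
        early-reject {k′} i Ei≤s eq k≡ t t<e with E i ℚₚ.≤? t
        ... | yes Ei≤t = ≤-pred (begin
          suc (idle′ t (assign (just i) (endOf j) E))  ≡⟨ idle′-update-released E i t<e Ei≤t ⟩
          idle′ t E             ≤⟨ lag t ⟩
          idle t cs + k         ≡⟨ cong (idle t cs +_) k≡ ⟩
          idle t cs + suc k′    ≡⟨ +-suc (idle t cs) k′ ⟩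
          suc (idle t cs + k′)  ∎)
          where open ≤-Reasoning
        ... | no Ei≰t = ≤-trans (≤-pred (begin
          suc (idle′ t (assign (just i) (endOf j) E))  ≡⟨ cong suc (idle′-update-busy E i t<e Ei≰t) ⟩
          suc (idle′ t E)          ≤⟨ released-between t i Ei≤s Ei≰t ⟩
          idle (startOf j) cs + k  ≡⟨ cong₂ _+_ (idle-none (startOf j) {cs} eq) k≡ ⟩
          suc k′                   ∎)) (m≤n+m k′ _)
          where open ≤-Reasoning

        -- The critical case is that `c` was idle at `t` but machine `i` was not: only the greedy
        -- count drops. By best fit the greedy schedule has as many idle machines at `t` as at the
        -- start of `j`, or more, while the other one has fewer at `t`; this gap of one pays for the
        -- drop.
        early-accept : ∀ {c fit} i → E i ℚ.≤ startOf j → filter fit? cs ≡ c ∷ fit →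
                       ∀ t → t ℚ.< endOf j →
                       idle′ t (assign (just i) (endOf j) E) ≤ idle t (placeIn j cs (c ∷ fit)) + k
        early-accept {c} {fit} i Ei≤s eq t t<e = cases (E i ℚₚ.≤? t) (lastEnd c ℚₚ.≤? t)
          where
          open ≤-Reasoning
          cs′ = placeIn j cs (c ∷ fit)
          E′ = assign (just i) (endOf j) E
          new≤ : idle t cs ≤ suc (idle t cs′)
          new≤ = ≤-trans (≤-reflexive (sym (idle-placed eq t t<e))) (+-monoˡ-≤ (idle t cs′) (indicator≤1 (lastEnd c ℚₚ.≤? t)))
          cases : Dec (E i ℚ.≤ t) → Dec (lastEnd c ℚ.≤ t) → idle′ t E′ ≤ idle t cs′ + k
          cases (yes Ei≤t) _ = ≤-pred (begin
            suc (idle′ t E′)      ≡⟨ idle′-update-released E i t<e Ei≤t ⟩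
            idle′ t E             ≤⟨ lag t ⟩
            idle t cs + k         ≤⟨ +-monoˡ-≤ k new≤ ⟩
            suc (idle t cs′ + k)  ∎)
          cases (no Ei≰t) (yes c≤t) = ≤-pred (begin
            suc (idle′ t E′)         ≡⟨ cong suc (idle′-update-busy E i t<e Ei≰t) ⟩
            suc (idle′ t E)          ≤⟨ released-between t i Ei≤s Ei≰t ⟩
            idle (startOf j) cs + k  ≤⟨ +-monoˡ-≤ k (idle-best-fit eq t c≤t) ⟩
            idle t cs + k            ≤⟨ +-monoˡ-≤ k new≤ ⟩
            suc (idle t cs′ + k)     ∎)
          cases (no Ei≰t) (no c≰t) = begin
            idle′ t E′          ≡⟨ idle′-update-busy E i t<e Ei≰t ⟩
            idle′ t E           ≤⟨ lag t ⟩
            idle t cs + k       ≡⟨ cong (_+ k) (sym (idle-placed-busy eq t t<e c≰t)) ⟩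
            idle t cs′ + k      ∎

        -- `x` stands for `d j` and `fs` for the fitting chains, so that the four outcomes can be
        -- split. The lead grows by one if only the greedy schedule accepts `j`, shrinks by one if
        -- only the other does, and is unchanged otherwise.
        lag-step : ∀ x {a} fs → filter fit? cs ≡ fs →
                   (∀ i → x ≡ just i → E i ℚ.≤ startOf j) →
                   length (placeIn j cs fs) ≡ m → All (λ c → lastEnd c ℚ.≤ endOf j) (placeIn j cs fs) →
                   total cs ≡ a + k →
                   ∃[ k′ ] total (placeIn j cs fs) ≡ (if is-just x then 1 else 0) + a + k′
                         × (∀ t → idle′ t (assign x (endOf j) E) ≤ idle t (placeIn j cs fs) + k′)
        lag-step nothing [] eq feasible len′ ended′ size = k , size , lag
        lag-step nothing {a} (c ∷ fit) eq feasible len′ ended′ size =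
          suc k , trans (placed-mass (const 1) j cs eq) (trans (cong suc size) (sym (+-suc a k))) ,
          lag-split {cs′ = placeIn j cs (c ∷ fit)} E len′ ended′ λ t t<e → begin
            idle′ t E                      ≤⟨ lag t ⟩
            idle t cs + k                  ≡⟨ cong (_+ k) (sym (idle-placed eq t t<e)) ⟩
            freeBy t c + idle t cs′ + k    ≤⟨ +-monoˡ-≤ k (+-monoˡ-≤ (idle t cs′) (indicator≤1 (lastEnd c ℚₚ.≤? t))) ⟩
            suc (idle t cs′ + k)           ≡⟨ sym (+-suc (idle t cs′) k) ⟩
            idle t cs′ + suc k             ∎
          where
          open ≤-Reasoning
          cs′ = placeIn j cs (c ∷ fit)
        lag-step (just i) {a} [] eq feasible len′ ended′ size = accept k refl
          where
          open ≤-Reasoning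
          -- At the start of `j` machine `i` is idle in the other schedule and none is in the greedy
          -- one, so there is a lead to spend.
          0<k : 1 ≤ k
          0<k = begin
            1                          ≤⟨ idle′-pos E i (feasible i refl) ⟩
            idle′ (startOf j) E        ≤⟨ lag (startOf j) ⟩
            idle (startOf j) cs + k    ≡⟨ cong (_+ k) (idle-none (startOf j) {cs} eq) ⟩
            k                          ∎
          accept : ∀ k″ → k ≡ k″ → ∃[ k′ ] total cs ≡ 1 + a + k′
                     × (∀ t → idle′ t (assign (just i) (endOf j) E) ≤ idle t cs + k′)
          accept zero     k≡ = contradiction (subst (1 ≤_) k≡ 0<k) λ ()
          accept (suc k′) k≡ = k′ , trans size (trans (cong (a +_) k≡) (+-suc a k′)) ,
            lag-split {cs′ = cs} (assign (just i) (endOf j) E) len ended (early-reject i (feasible i refl) eq k≡)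
        lag-step (just i) {a} (c ∷ fit) eq feasible len′ ended′ size =
          k , trans (placed-mass (const 1) j cs eq) (cong suc size) ,
          lag-split {cs′ = placeIn j cs (c ∷ fit)} (assign (just i) (endOf j) E) len′ ended′ (early-accept i (feasible i refl) eq)

      -- The greedy schedule may have fewer idle machines, but by no more than
      -- its lead k in accepted intervals.
      run-lead : ∀ {js} → AllPairs _≽_ js → Feasible js →
                 ∃[ k ] total (run js) ≡ sumBy accepted js + k
                      × (∀ t → idle′ t (lastEnds js) ≤ idle t (run js) + k)
      run-lead [] [] = 0 , total-empty m , λ t → begin
        idle′ t (const 0ℚ)                            ≡⟨ initial m t ⟩
        idle t (replicate m [])                       ≡⟨ sym (+-identityʳ _) ⟩
        idle t (replicate m []) + 0                   ∎
        where
        open ≤-Reasoning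
        total-empty : ∀ m → total (replicate m []) ≡ 0
        total-empty zero    = refl
        total-empty (suc m) = total-empty m
        initial : ∀ m t → sum {m} (λ _ → indicator (0ℚ ℚₚ.≤? t)) ≡ idle t (replicate m [])
        initial zero    t = refl
        initial (suc m) t = cong (indicator (0ℚ ℚₚ.≤? t) +_) (initial m t)
      run-lead {j ∷ js} (p ∷ ps) (f ∷ fs) with run-lead ps fs
      ... | k , size , lag =
        lag-step j (run js) (lastEnds js) k (run-length js) (run-ended js (0≤end j) p) (run-sorted ps) lag
          (d j) _ refl f (run-length (j ∷ js))
          (place-ended j (run js) ℚₚ.≤-refl (run-ended js (0≤end j) p)) size

-- Cutting two machines and exchanging their parts

module _ {A : Set} {P Q : A → Set} (P? : Decidable P) (Q? : Decidable Q) where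

  length-filter-mono : (∀ x → P x → Q x) → ∀ xs → length (filter P? xs) ≤ length (filter Q? xs)
  length-filter-mono P⇒Q []       = z≤n
  length-filter-mono P⇒Q (x ∷ xs) with P? x | Q? x
  ... | yes p | yes q = s≤s (length-filter-mono P⇒Q xs)
  ... | yes p | no ¬q = contradiction (P⇒Q x p) ¬q
  ... | no ¬p | yes q = m≤n⇒m≤1+n (length-filter-mono P⇒Q xs)
  ... | no ¬p | no ¬q = length-filter-mono P⇒Q xs

length-filter-∷ : ∀ {A : Set} {P : A → Set} (P? : Decidable P) x xs →
                  length (filter P? xs) ≤ length (filter P? (x ∷ xs))
length-filter-∷ P? x xs with P? x
... | yes _ = n≤1+n _
... | no _  = ≤-refl

sumBy-tight : ∀ {A : Set} (w : A → ℕ) {b xs} → All (λ x → w x ≤ b) xs → length xs * b ≤ sumBy w xs →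
              All (λ x → w x ≡ b) xs
sumBy-tight w []       _  = []
sumBy-tight w {b} {x ∷ xs} (p ∷ ps) le = ≤-antisym p b≤wx ∷ sumBy-tight w ps rest
  where
  b≤wx : b ≤ w x
  b≤wx = +-cancelʳ-≤ (length xs * b) b (w x) (≤-trans le (+-monoʳ-≤ (w x) (sumBy≤length* w ps)))
  rest : length xs * b ≤ sumBy w xs
  rest = +-cancelˡ-≤ b (length xs * b) (sumBy w xs) (≤-trans le (+-monoˡ-≤ (sumBy w xs) p))

-- Rounding down: `a` is at most `r / u`, which is below `suc b`. Used in both directions, it
-- identifies an average known in two ways.
*-suc-cancel : ∀ u {a b r} → u * a ≤ r → r < u * suc b → a ≤ b
*-suc-cancel u {a} {b} p q = ≤-pred (*-cancelˡ-< u a (suc b) (≤-<-trans p q))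

module Balancing {n : ℕ} (I : Instance n) where

  open Algorithm I
  open GreedyOptimality I using (valid⇒ended)

  after-antitone : ∀ {s t} c → s ℚ.≤ t → length (after t c) ≤ length (after s c)
  after-antitone {s} {t} c s≤t =
    length-filter-mono (λ j → t ℚₚ.≤? startOf j) (λ j → s ℚₚ.≤? startOf j) (λ _ → ℚₚ.≤-trans s≤t) c

  after-0 : ∀ c → after 0ℚ c ≡ c
  after-0 c = filter-all (λ j → 0ℚ ℚₚ.≤? startOf j) (All.universal 0≤start c)

  lastEnd-tail : ∀ {j c} → Valid (j ∷ c) → lastEnd c ℚ.≤ endOf j
  lastEnd-tail {j} {[]}    _ = ℚₚ.≤-trans (0≤start j) (ℚₚ.<⇒≤ (start<endOf j))
  lastEnd-tail {j} {k ∷ c} ((b ∷ _) ∷ _) = ℚₚ.≤-trans b (ℚₚ.<⇒≤ (start<endOf j))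

  after-before-exclusive : ∀ {t} j → t ℚ.≤ startOf j → ¬ (endOf j ℚ.≤ t)
  after-before-exclusive j t≤s e≤t = <⇒≱ℚ (start<endOf j) (ℚₚ.≤-trans e≤t t≤s)

  before-all : ∀ {t c} → All (λ j → endOf j ℚ.≤ t) c → before t c ≡ c
  before-all {t} = filter-all (λ j → endOf j ℚₚ.≤? t)

  -- Only one interval of a chain can contain t in its interior.
  crossing : ∀ t {c} → Valid c → length c ≤ suc (length (after t c) + length (before t c))
  crossing t {[]} [] = z≤n
  crossing t {j ∷ c} (bs ∷ v) = cases (t ℚₚ.≤? startOf j)
    where
    open ≤-Reasoning
    before≤ : length (before t c) ≤ length (before t (j ∷ c))
    before≤ = length-filter-∷ (λ k → endOf k ℚₚ.≤? t) j c
    cases : Dec (t ℚ.≤ startOf j) → length (j ∷ c) ≤ suc (length (after t (j ∷ c)) + length (before t (j ∷ c)))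
    cases (yes t≤j) = begin
      suc (length c)                                               ≤⟨ s≤s (crossing t v) ⟩
      suc (suc (length (after t c)) + length (before t c))
        ≡⟨ cong (λ d → suc (length d + length (before t c))) (sym (filter-accept (λ k → t ℚₚ.≤? startOf k) t≤j)) ⟩
      suc (length (after t (j ∷ c)) + length (before t c))         ≤⟨ s≤s (+-monoʳ-≤ (length (after t (j ∷ c))) before≤) ⟩
      suc (length (after t (j ∷ c)) + length (before t (j ∷ c)))   ∎
    cases (no t≰j) = s≤s (begin
      length c                                                     ≡⟨ cong length (sym (before-all (All.map (λ b → ℚₚ.≤-trans b (≰⇒≥ℚ t≰j)) bs))) ⟩
      length (before t c)                                          ≤⟨ before≤ ⟩
      length (before t (j ∷ c))                                    ≤⟨ m≤n+m _ (length (after t (j ∷ c))) ⟩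
      length (after t (j ∷ c)) + length (before t (j ∷ c))         ∎)

  suffix-valid : ∀ b₂ {b₁} → Valid (b₂ ++ b₁) → Valid b₁
  suffix-valid []       v       = v
  suffix-valid (_ ∷ b₂) (_ ∷ v) = suffix-valid b₂ v

  -- The state after `k` rounds. Either the size has come down to `τ`, where `at-least` makes it
  -- exact, or each round so far has removed an interval of `b`.
  record CutPoint (τ k : ℕ) (a b b₁ : Chain) : Set where
    field
      dropped   : Chain
      split     : b ≡ dropped ++ b₁
      at-least  : τ ≤ cutSize a b₁
      progress  : cutSize a b₁ ≤ τ ⊎ length b₁ + k ≤ length b

  cutPoint-spec : ∀ {τ a b} → Valid b → length a ≤ τ → τ ≤ length b →
                  ∃[ b₂ ] b ≡ b₂ ++ cutPoint τ a b × cutSize a (cutPoint τ a b) ≡ τ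
  cutPoint-spec {τ} {a} {b} vb a≤τ τ≤b = finish (iterate b)
    where
    open CutPoint
    next : Chain → Chain
    next b′ = if does (cutSize a b′ ≤? τ) then b′ else drop 1 b′

    next-spec : ∀ {k} b₁ → CutPoint τ k a b b₁ → Valid b₁ → CutPoint τ (suc k) a b (next b₁)
    next-spec {k} b₁ p v = if-elim (CutPoint τ (suc k) a b) (cutSize a b₁ ≤? τ)
      (λ small → record { dropped = dropped p ; split = split p ; at-least = at-least p ; progress = inj₁ small })
      (shorten b₁ p v)
      where
      shorten : ∀ b₁ → CutPoint τ k a b b₁ → Valid b₁ → ¬ (cutSize a b₁ ≤ τ) → CutPoint τ (suc k) a b (drop 1 b₁)
      -- `lastEnd []` is `0` and no interval starts before `0`, so with nothing of `b` left the size
      -- is `length a`, at most `τ`.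
      shorten [] p v big = contradiction (≤-trans (≤-reflexive (cong length (after-0 a))) a≤τ) big
      shorten (x ∷ b₁) p v big = record
        { dropped  = dropped p ++ [ x ]
        ; split    = trans (split p) (sym (++-assoc (dropped p) [ x ] b₁))
        -- The size was at least `suc τ`. The part of `b` loses one interval, and the part of `a`
        -- cannot shrink when the cut moves back.
        ; at-least = ≤-pred (≤-trans (≰⇒> big) (s≤s (+-monoʳ-≤ (length b₁) (after-antitone a (lastEnd-tail v)))))
        ; progress = inj₂ (shrink (progress p))
        }
        where
        shrink : cutSize a (x ∷ b₁) ≤ τ ⊎ suc (length b₁) + k ≤ length b → length b₁ + suc k ≤ length b
        shrink (inj₁ small) = contradiction small big
        shrink (inj₂ le) = ≤-trans (≤-reflexive (+-suc (length b₁) k)) le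

    iterate : ∀ xs → CutPoint τ (length xs) a b (foldr (λ (_ : Fin n) → next) b xs)
    iterate [] = record { dropped = [] ; split = refl ; at-least = ≤-trans τ≤b (m≤m+n _ _)
                        ; progress = inj₂ (≤-reflexive (+-identityʳ _)) }
    iterate (_ ∷ xs) = next-spec _ p (suffix-valid (dropped p) (subst Valid (split p) vb))
      where p = iterate xs

    finish : ∀ {b₁} → CutPoint τ (length b) a b b₁ → ∃[ b₂ ] b ≡ b₂ ++ b₁ × cutSize a b₁ ≡ τ
    finish {b₁} p with progress p
    ... | inj₁ small = dropped p , split p , ≤-antisym small (at-least p)
    finish {[]} p | inj₂ _ = dropped p , split p ,
      ≤-antisym (≤-trans (≤-reflexive (cong length (after-0 a))) a≤τ) (at-least p)
    finish {x ∷ b₁} p | inj₂ le = contradiction le (<⇒≱ (s≤s (m≤n+m (length b) (length b₁))))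

  -- The cut is an end time of `b`, or `0`, so no interval of `b` crosses it: the late part
  -- recovered by filtering is exactly what `cutPoint` dropped.
  after-prefix : ∀ b₂ {b₁} → Valid (b₂ ++ b₁) → after (lastEnd b₁) (b₂ ++ b₁) ≡ b₂
  after-prefix [] {b₁} v = filter-none (λ j → lastEnd b₁ ℚₚ.≤? startOf j)
    (All.map (λ e le → after-before-exclusive _ le e) (valid⇒ended v))
  after-prefix (j ∷ b₂) {b₁} (bs ∷ v) = trans
    (filter-accept (λ j → lastEnd b₁ ℚₚ.≤? startOf j) (late b₁ (Allₚ.++⁻ʳ b₂ bs)))
    (cong (j ∷_) (after-prefix b₂ v))
    where
    late : ∀ b₁ → All (Before j) b₁ → lastEnd b₁ ℚ.≤ startOf j
    late []       _       = 0≤start j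
    late (_ ∷ _) (b ∷ _) = b

  -- The loss is a number, not a case distinction, so that `remainder` is an equation. `loss≤1`
  -- controls the averages, while `2*loss≤τ` yields the price.
  record Cut (τ : ℕ) (a b : Chain) (cd : Chain × Chain) : Set where
    field
      loss       : ℕ
      exact      : length (proj₁ cd) ≡ τ
      remainder  : length (proj₂ cd) + τ + loss ≡ length a + length b
      loss≤1     : loss ≤ 1
      2*loss≤τ   : 2 * loss ≤ τ
      valid₁     : Valid (proj₁ cd)
      valid₂     : Valid (proj₂ cd)
      mass≤      : ∀ w → sumBy w (proj₁ cd) + sumBy w (proj₂ cd) ≤ sumBy w a + sumBy w b

  cut-at : ∀ {τ a} b₂ b₁ → Valid a → Valid (b₂ ++ b₁) → ¬ (τ ≤ length a) → cutSize a b₁ ≡ τ →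
           let t = lastEnd b₁ in
           Cut τ a (b₂ ++ b₁) (after t a ++ b₁ , after t (b₂ ++ b₁) ++ before t a)
  cut-at {τ} {a} b₂ b₁ va vb τ≰a size = record
    { loss = loss
    ; exact = trans (length-++ (after t a)) (trans (+-comm (length (after t a)) (length b₁)) size)
    ; remainder = remainder
    ; loss≤1 = m≤n+o⇒m∸n≤o (length a) kept (≤-trans (crossing t va) (≤-reflexive (+-comm 1 kept)))
    ; 2*loss≤τ = small a kept (m≤n+o⇒m∸n≤o (length a) kept (≤-trans (crossing t va) (≤-reflexive (+-comm 1 kept)))) τ≰a
    ; valid₁ = AllPairsₚ.++⁺ (AllPairsₚ.filter⁺ (λ j → t ℚₚ.≤? startOf j) va) v₁
                 (All.map (λ le → All.map (λ e → ℚₚ.≤-trans e le) (valid⇒ended v₁)) late)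
    ; valid₂ = subst Valid (cong (_++ before t a) (sym after-b)) (AllPairsₚ.++⁺ v₂ (AllPairsₚ.filter⁺ (λ j → endOf j ℚₚ.≤? t) va)
                 (All.map (λ le → All.map (λ e → ℚₚ.≤-trans e le) early)
                   (subst (All (λ j → t ℚ.≤ startOf j)) after-b (Allₚ.all-filter (λ j → t ℚₚ.≤? startOf j) (b₂ ++ b₁)))))
    ; mass≤ = mass≤
    }
    where
    t = lastEnd b₁
    kept = length (after t a) + length (before t a)
    loss = length a ∸ kept
    after-b : after t (b₂ ++ b₁) ≡ b₂
    after-b = after-prefix b₂ vb
    late = Allₚ.all-filter (λ j → t ℚₚ.≤? startOf j) a
    early = Allₚ.all-filter (λ j → endOf j ℚₚ.≤? t) a
    v₁ = suffix-valid b₂ vb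
    v₂ : Valid b₂
    v₂ = subst Valid after-b (AllPairsₚ.filter⁺ (λ j → t ℚₚ.≤? startOf j) vb)

    small : ∀ a kept → length a ∸ kept ≤ 1 → ¬ (τ ≤ length a) → 2 * (length a ∸ kept) ≤ τ
    small []      kept p τ≰a rewrite 0∸n≡0 kept = z≤n
    small (_ ∷ a) kept p τ≰a = ≤-trans (*-monoʳ-≤ 2 p) (≤-trans (s≤s (s≤s z≤n)) (≰⇒> τ≰a))

    kept≤ : kept ≤ length a
    kept≤ = sumBy-exclusive one (λ j → t ℚₚ.≤? startOf j) (λ j → endOf j ℚₚ.≤? t) after-before-exclusive a

    remainder : length (after t (b₂ ++ b₁) ++ before t a) + τ + loss ≡ length a + length (b₂ ++ b₁)
    remainder = begin
      length (after t (b₂ ++ b₁) ++ before t a) + τ + loss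
        ≡⟨ cong₂ (λ l k → l + k + loss) (trans (length-++ (after t (b₂ ++ b₁))) (cong (λ c → length c + length (before t a)) after-b)) (sym size) ⟩
      length b₂ + length (before t a) + (length b₁ + length (after t a)) + loss
        ≡⟨ solve 5 (λ p q r s l → p :+ q :+ (r :+ s) :+ l := s :+ q :+ l :+ (p :+ r)) refl (length b₂) (length (before t a)) (length b₁) (length (after t a)) loss ⟩
      kept + loss + (length b₂ + length b₁)
        ≡⟨ cong₂ _+_ (m+[n∸m]≡n kept≤) (sym (length-++ b₂)) ⟩
      length a + length (b₂ ++ b₁) ∎
      where
      open +-*-Solver
      open ≡-Reasoning

    mass≤ : ∀ w → sumBy w (after t a ++ b₁) + sumBy w (after t (b₂ ++ b₁) ++ before t a) ≤ sumBy w a + sumBy w (b₂ ++ b₁)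
    mass≤ w = begin
      sumBy w (after t a ++ b₁) + sumBy w (after t (b₂ ++ b₁) ++ before t a)
        ≡⟨ cong₂ _+_ (sumBy-++ w (after t a) b₁) (trans (sumBy-++ w (after t (b₂ ++ b₁)) _) (cong (λ c → sumBy w c + sumBy w (before t a)) after-b)) ⟩
      sumBy w (after t a) + sumBy w b₁ + (sumBy w b₂ + sumBy w (before t a))
        ≡⟨ solve 4 (λ p q r s → p :+ q :+ (r :+ s) := (p :+ s) :+ (r :+ q)) refl (sumBy w (after t a)) (sumBy w b₁) (sumBy w b₂) (sumBy w (before t a)) ⟩
      sumBy w (after t a) + sumBy w (before t a) + (sumBy w b₂ + sumBy w b₁)
        ≤⟨ +-mono-≤ (sumBy-exclusive w (λ j → t ℚₚ.≤? startOf j) (λ j → endOf j ℚₚ.≤? t) after-before-exclusive a)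
                    (≤-reflexive (sym (sumBy-++ w b₂ b₁))) ⟩
      sumBy w a + sumBy w (b₂ ++ b₁) ∎
      where
      open +-*-Solver
      open ≤-Reasoning

  cut-spec : ∀ {τ a b} → Valid a → Valid b → length a ≤ τ → τ ≤ length b → Cut τ a b (cut τ a b)
  cut-spec {τ} {a} {b} va vb a≤τ τ≤b = if-elim (Cut τ a b) (τ ≤? length a)
    (λ τ≤a → record
      { loss = 0 ; exact = ≤-antisym a≤τ τ≤a
      ; remainder = trans (+-identityʳ _) (trans (+-comm (length b) τ) (cong (_+ length b) (≤-antisym τ≤a a≤τ)))
      ; loss≤1 = z≤n ; 2*loss≤τ = z≤n ; valid₁ = va ; valid₂ = vb ; mass≤ = λ w → ≤-refl })
    (λ τ≰a → let b₁ = cutPoint τ a b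
                 b₂ , split , size = cutPoint-spec {τ} {a} {b} vb a≤τ τ≤b in
      subst (λ b′ → Cut τ a b′ (after (lastEnd b₁) a ++ b₁ , after (lastEnd b₁) b′ ++ before (lastEnd b₁) a))
        (sym split) (cut-at b₂ b₁ va (subst Valid split vb) τ≰a size))

-- Arithmetic of the averages

-- Phase₀: every chain fixed so far has length T, and the u remaining chains
-- have average in [T, T+1).  Phase₁: the fixed chains have length T or T+1, and
-- the remaining ones lack δ ≤ 1 of having average T+1.
Phase₀ : (T u R : ℕ) → Set
Phase₀ T u R = ∃[ q ] R ≡ u * T + q × q < u

Phase₁ : (T u R : ℕ) → Set
Phase₁ T u R = ∃[ δ ] R + δ ≡ u * suc T × δ ≤ 1

phase₀-average : ∀ {τ T u R} → Phase₀ T u R → u * τ ≤ R → R < u * suc τ → τ ≡ T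
phase₀-average {τ} {T} {u} {R} (q , eq , q<u) lo hi = ≤-antisym
  (*-suc-cancel u lo (begin-strict
    R            ≡⟨ eq ⟩
    u * T + q    <⟨ +-monoʳ-< (u * T) q<u ⟩
    u * T + u   ≡⟨ solve 2 (λ u T → u :* T :+ u := u :* (con 1 :+ T)) refl u T ⟩
    u * suc T    ∎))
  (*-suc-cancel u (≤-trans (m≤m+n _ q) (≤-reflexive (sym eq))) hi)
  where
  open ≤-Reasoning
  open +-*-Solver

module _ {u τ R R′ ℓ : ℕ} (remainder : R′ + τ + ℓ ≡ R) where

  -- The excess `q` over a multiple of `τ` absorbs a loss if it is positive. If `q` is zero, a loss
  -- leaves the rest one short of average `τ`, which is then the upper of the two values. Without a
  -- loss, `q ≡ u` means that the rest has average exactly `suc τ`.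
  phase₀-step : Phase₀ τ (suc u) R → ℓ ≤ 1 → 2 * ℓ ≤ τ →
                Phase₀ τ u R′ ⊎ Phase₁ τ u R′ ⊎ (∃[ T ] τ ≡ suc T × Phase₁ T u R′)
  phase₀-step (q , eq , q<u) ℓ≤1 2ℓ≤τ = cases ℓ q ℓ≤1 2ℓ≤τ q<u balance-eq
    where
    open +-*-Solver
    balance-eq : R′ + ℓ ≡ u * τ + q
    balance-eq = +-cancelˡ-≡ τ _ _ (trans
      (solve 3 (λ r t l → t :+ (r :+ l) := r :+ t :+ l) refl R′ τ ℓ)
      (trans remainder (trans eq (+-assoc τ (u * τ) q))))
    last : ∀ τ → 2 ≤ τ → R′ + 1 ≡ u * τ → ∃[ T ] τ ≡ suc T × Phase₁ T u R′
    last (suc T) _ e = T , refl , 1 , e , ≤-refl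
    cases : ∀ ℓ q → ℓ ≤ 1 → 2 * ℓ ≤ τ → q < suc u → R′ + ℓ ≡ u * τ + q →
            Phase₀ τ u R′ ⊎ Phase₁ τ u R′ ⊎ (∃[ T ] τ ≡ suc T × Phase₁ T u R′)
    cases zero q _ _ q<su e with m≤n⇒m<n∨m≡n (≤-pred q<su)
    ... | inj₁ q<u  = inj₁ (q , trans (sym (+-identityʳ R′)) e , q<u)
    ... | inj₂ refl = inj₂ (inj₁ (0 , trans e (solve 2 (λ u T → u :* T :+ u := u :* (con 1 :+ T)) refl u τ) , z≤n))
    cases (suc zero) (suc q) _ _ q<su e = inj₁ (q , suc-injective (trans (+-comm 1 R′) (trans e (+-suc (u * τ) q))) , ≤-pred q<su)
    cases (suc zero) zero _ 2≤τ _ e = inj₂ (inj₂ (last τ 2≤τ (trans e (+-identityʳ _))))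
    cases (suc (suc _)) _ (s≤s ()) _ _ _

  -- Deficits do not accumulate. With `δ ≡ 0` a chain of length `suc T` is fixed; with `δ ≡ 1` the
  -- average rounds down to `T`, and fixing a chain of that length uses up the deficit. Either way
  -- the new deficit is the current loss.
  phase₁-step : ∀ {T} → Phase₁ T (suc u) R → suc u * τ ≤ R → R < suc u * suc τ → ℓ ≤ 1 →
                T ≤ τ × τ ≤ suc T × Phase₁ T u R′
  phase₁-step {T} (zero , eq , _) lo hi ℓ≤1 = ≤-trans (n≤1+n T) (≤-reflexive (sym τ≡)) , ≤-reflexive τ≡ , ℓ , eq′ , ℓ≤1
    where
    open +-*-Solver
    R≡ : R ≡ suc u * suc T
    R≡ = trans (sym (+-identityʳ R)) eq
    τ≡ : τ ≡ suc T
    τ≡ = ≤-antisym (*-cancelˡ-≤ (suc u) (subst (suc u * τ ≤_) R≡ lo))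
                   (*-suc-cancel (suc u) (≤-reflexive (sym R≡)) hi)
    eq′ : R′ + ℓ ≡ u * suc T
    eq′ = +-cancelˡ-≡ (suc T) _ _ (trans (solve 3 (λ r t l → t :+ (r :+ l) := r :+ t :+ l) refl R′ (suc T) ℓ)
            (trans (cong (λ t → R′ + t + ℓ) (sym τ≡)) (trans remainder R≡)))
  phase₁-step {T} (suc zero , eq , _) lo hi ℓ≤1 = ≤-reflexive (sym τ≡) , ≤-trans (≤-reflexive τ≡) (n≤1+n T) , ℓ , eq′ , ℓ≤1
    where
    open +-*-Solver
    open ≤-Reasoning
    τ≡ : τ ≡ T
    τ≡ = ≤-antisym
      (*-suc-cancel (suc u) lo (≤-reflexive (trans (+-comm 1 R) eq)))
      (*-suc-cancel (suc u) (+-cancelʳ-≤ 1 _ _ (begin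
        suc u * T + 1        ≤⟨ +-monoʳ-≤ (suc u * T) (s≤s z≤n) ⟩
        suc u * T + suc u    ≡⟨ solve 2 (λ u T → u :* T :+ u := u :* (con 1 :+ T)) refl (suc u) T ⟩
        suc u * suc T        ≡⟨ sym eq ⟩
        R + 1                ∎)) hi)
    eq′ : R′ + ℓ ≡ u * suc T
    eq′ = +-cancelˡ-≡ (suc T) _ _ (begin-equality
      suc T + (R′ + ℓ)      ≡⟨ solve 3 (λ r t l → (con 1 :+ t) :+ (r :+ l) := r :+ t :+ l :+ con 1) refl R′ T ℓ ⟩
      R′ + T + ℓ + 1        ≡⟨ cong (λ t → R′ + t + ℓ + 1) (sym τ≡) ⟩
      R′ + τ + ℓ + 1        ≡⟨ cong (_+ 1) remainder ⟩
      R + 1                 ≡⟨ eq ⟩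
      suc u * suc T         ∎)
  phase₁-step (suc (suc _) , _ , s≤s ()) _ _ _

-- The rebalancing loop

module Balance {n : ℕ} (I : Instance n) where

  open Algorithm I
  open Balancing I

  -- Either a trial has failed, which gives the upper bound, or all `n` have succeeded, and then the
  -- value is at least `n` and thus at least the total.
  average-spec : ∀ cs → 1 ≤ length cs → total cs ≤ n →
                 length cs * average cs ≤ total cs × total cs < length cs * suc (average cs)
  average-spec cs u≥1 R≤n = lower (allFin n) , upper (largest (allFin n))
    where
    u = length cs
    R = total cs
    try : Fin n → ℕ → ℕ
    try _ τ = if does (u * suc τ ≤? R) then suc τ else τ
    lower : ∀ xs → u * foldr try 0 xs ≤ R
    lower [] = ≤-trans (≤-reflexive (*-zeroʳ u)) z≤n
    lower (x ∷ xs) = if-elim (λ τ → u * τ ≤ R) (u * suc (foldr try 0 xs) ≤? R) (λ p → p) (λ _ → lower xs)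
    largest : ∀ xs → R < u * suc (foldr try 0 xs) ⊎ length xs ≤ foldr try 0 xs
    largest [] = inj₂ z≤n
    largest (x ∷ xs) = if-elim (λ τ → R < u * suc τ ⊎ suc (length xs) ≤ τ) (u * suc (foldr try 0 xs) ≤? R)
      (λ p → next p (largest xs)) (λ ¬p → inj₁ (≰⇒> ¬p))
      where
      next : u * suc (foldr try 0 xs) ≤ R → R < u * suc (foldr try 0 xs) ⊎ length xs ≤ foldr try 0 xs → _
      next p (inj₁ q) = contradiction p (<⇒≱ q)
      next p (inj₂ q) = inj₂ (s≤s q)
    upper : R < u * suc (average cs) ⊎ length (allFin n) ≤ average cs → R < u * suc (average cs)
    upper (inj₁ p) = p
    upper (inj₂ p) = begin-strict
      R                       ≤⟨ R≤n ⟩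
      n                       ≡⟨ sym (length-tabulate (λ (i : Fin n) → i)) ⟩
      length (allFin n)       ≤⟨ p ⟩
      average cs              <⟨ n<1+n _ ⟩
      suc (average cs)        ≡⟨ sym (*-identityˡ _) ⟩
      1 * suc (average cs)    ≤⟨ *-monoˡ-≤ (suc (average cs)) u≥1 ⟩
      u * suc (average cs)    ∎
      where open ≤-Reasoning

  Between : ℕ → Chain → Set
  Between T c = T ≤ length c × length c ≤ suc T

  Equitable : List Chain → Set
  Equitable cs = ∃[ T ] All (Between T) cs

  module _ (cs₀ : List Chain) (small : total cs₀ ≤ n) where

    -- `price` is a potential: a remaining interval counts 2, a fixed one 3. Fixing `τ` intervals
    -- raises it by `τ`, and losing some lowers it by `2 * loss`. `some` keeps the average
    -- meaningful, as a round replaces two remaining chains by one.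
    record Invariant (s : State) : Set where
      private
        unf = proj₁ s
        fix = proj₂ s
      field
        phase  : ∃[ T ] ((All (λ c → length c ≡ T) fix × Phase₀ T (length unf) (total unf))
                        ⊎ (All (Between T) fix × Phase₁ T (length unf) (total unf)))
        some   : 1 ≤ length unf
        count  : length unf + length fix ≡ length cs₀
        valid₁ : All Valid unf
        valid₂ : All Valid fix
        mass≤  : ∀ w → mass w unf + mass w fix ≤ mass w cs₀
        price  : 2 * total cs₀ ≤ 2 * total unf + 3 * total fix

    low? : ∀ τ (c : Chain) → Dec (length c ≤ τ)
    low? τ c = length c ≤? τ

    high? : ∀ τ (c : Chain) → Dec (suc τ ≤ length c)
    high? τ c = suc τ ≤? length c

    low-high-exclusive : ∀ τ (c : Chain) → length c ≤ τ → ¬ (suc τ ≤ length c)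
    low-high-exclusive τ c p q = <⇒≱ q p

    low-high-cover : ∀ τ (c : Chain) → length c ≤ τ ⊎ suc τ ≤ length c
    low-high-cover τ c = ≤-<-connex (length c) τ

    sumBy-low-high : ∀ (f : Chain → ℕ) τ cs → sumBy f (filter (low? τ) cs) + sumBy f (filter (high? τ) cs) ≡ sumBy f cs
    sumBy-low-high f τ cs = ≤-antisym (sumBy-exclusive f (low? τ) (high? τ) (low-high-exclusive τ) cs)
                                      (sumBy-cover f (low? τ) (high? τ) (low-high-cover τ) cs)

    -- After `k` rounds, unless no chain exceeds the average, `k` chains have left the remaining
    -- ones.
    Progress : ℕ → State → Set
    Progress k s = filter (high? (average (proj₁ s))) (proj₁ s) ≡ [] ⊎ length (proj₁ s) + k ≤ length cs₀

    module Replace {unf fix lo hi : List Chain} {a b c d : Chain} {τ : ℕ} (inv : Invariant (unf , fix))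
                   (bounds : length unf * τ ≤ total unf × total unf < length unf * suc τ)
                   (lo-eq : filter (low? τ) unf ≡ a ∷ lo) (hi-eq : filter (high? τ) unf ≡ b ∷ hi)
                   (ab-cut : Cut τ a b (c , d)) where

      open Invariant inv
      open Cut ab-cut renaming (mass≤ to cut-mass≤; valid₁ to cut-valid₁; valid₂ to cut-valid₂)

      private
        unf′ : List Chain
        unf′ = d ∷ lo ++ hi

      -- One identity gives the number of chains, their total and their mass, by the choice of `f`.
      others : ∀ f → f a + f b + sumBy f (lo ++ hi) ≡ sumBy f unf
      others f = begin
        f a + f b + sumBy f (lo ++ hi)            ≡⟨ cong (f a + f b +_) (sumBy-++ f lo hi) ⟩
        f a + f b + (sumBy f lo + sumBy f hi)     ≡⟨ solve 4 (λ a b l h → a :+ b :+ (l :+ h) := (a :+ l) :+ (b :+ h)) refl (f a) (f b) (sumBy f lo) (sumBy f hi) ⟩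
        sumBy f (a ∷ lo) + sumBy f (b ∷ hi)       ≡⟨ cong₂ (λ l h → sumBy f l + sumBy f h) (sym lo-eq) (sym hi-eq) ⟩
        sumBy f (filter (low? τ) unf) + sumBy f (filter (high? τ) unf)  ≡⟨ sumBy-low-high f τ unf ⟩
        sumBy f unf ∎
        where
        open +-*-Solver
        open ≡-Reasoning

      count′ : suc (length unf′) ≡ length unf
      count′ = others (const 1)

      remaining : total unf′ + τ + loss ≡ total unf
      remaining = begin
        length d + total (lo ++ hi) + τ + loss      ≡⟨ solve 4 (λ d r t l → d :+ r :+ t :+ l := d :+ t :+ l :+ r) refl (length d) (total (lo ++ hi)) τ loss ⟩
        length d + τ + loss + total (lo ++ hi)      ≡⟨ cong (_+ total (lo ++ hi)) remainder ⟩
        length a + length b + total (lo ++ hi)      ≡⟨ others length ⟩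
        total unf ∎
        where
        open +-*-Solver
        open ≡-Reasoning

      mass′ : ∀ w → mass w unf′ + mass w (c ∷ fix) ≤ mass w cs₀
      mass′ w = begin
        sumBy w d + mass w (lo ++ hi) + (sumBy w c + mass w fix)
          ≡⟨ solve 4 (λ d r c f → d :+ r :+ (c :+ f) := c :+ d :+ r :+ f) refl (sumBy w d) (mass w (lo ++ hi)) (sumBy w c) (mass w fix) ⟩
        sumBy w c + sumBy w d + mass w (lo ++ hi) + mass w fix
          ≤⟨ +-monoˡ-≤ (mass w fix) (+-monoˡ-≤ (mass w (lo ++ hi)) (cut-mass≤ w)) ⟩
        sumBy w a + sumBy w b + mass w (lo ++ hi) + mass w fix ≡⟨ cong (_+ mass w fix) (others (sumBy w)) ⟩
        mass w unf + mass w fix  ≤⟨ mass≤ w ⟩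
        mass w cs₀ ∎
        where
        open +-*-Solver
        open ≤-Reasoning

      price′ : 2 * total cs₀ ≤ 2 * total unf′ + 3 * total (c ∷ fix)
      price′ = begin
        2 * total cs₀                                         ≤⟨ price ⟩
        2 * total unf + 3 * total fix                         ≡⟨ cong (λ R → 2 * R + 3 * total fix) (sym remaining) ⟩
        2 * (total unf′ + τ + loss) + 3 * total fix
          ≡⟨ solve 4 (λ r t l f → con 2 :* (r :+ t :+ l) :+ con 3 :* f := con 2 :* r :+ (con 2 :* t :+ con 2 :* l) :+ con 3 :* f) refl (total unf′) τ loss (total fix) ⟩
        2 * total unf′ + (2 * τ + 2 * loss) + 3 * total fix
          ≤⟨ +-monoˡ-≤ (3 * total fix) (+-monoʳ-≤ (2 * total unf′) (+-monoʳ-≤ (2 * τ) 2*loss≤τ)) ⟩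
        2 * total unf′ + (2 * τ + τ) + 3 * total fix
          ≡⟨ solve 3 (λ r t f → con 2 :* r :+ (con 2 :* t :+ t) :+ con 3 :* f := con 2 :* r :+ con 3 :* (t :+ f)) refl (total unf′) τ (total fix) ⟩
        2 * total unf′ + 3 * (τ + total fix)                  ≡⟨ cong (λ l → 2 * total unf′ + 3 * (l + total fix)) (sym exact) ⟩
        2 * total unf′ + 3 * total (c ∷ fix) ∎
        where
        open +-*-Solver
        open ≤-Reasoning

      phase′ : ∃[ T ] ((All (λ c → length c ≡ T) (c ∷ fix) × Phase₀ T (length unf′) (total unf′))
                      ⊎ (All (Between T) (c ∷ fix) × Phase₁ T (length unf′) (total unf′)))
      phase′ = cases phase
        where
        lo-bound : suc (length unf′) * τ ≤ total unf
        lo-bound = subst (λ u → u * τ ≤ total unf) (sym count′) (proj₁ bounds)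
        hi-bound : total unf < suc (length unf′) * suc τ
        hi-bound = subst (λ u → total unf < u * suc τ) (sym count′) (proj₂ bounds)
        from₀ : All (λ c → length c ≡ τ) fix →
                Phase₀ τ (length unf′) (total unf′) ⊎ Phase₁ τ (length unf′) (total unf′)
                  ⊎ (∃[ T ] τ ≡ suc T × Phase₁ T (length unf′) (total unf′)) → _
        from₀ all (inj₁ p) = τ , inj₁ (exact ∷ all , p)
        from₀ all (inj₂ (inj₁ p)) = τ , inj₂
          (All.map (λ e → ≤-reflexive (sym e) , ≤-trans (≤-reflexive e) (n≤1+n τ)) (exact ∷ all) , p)
        from₀ all (inj₂ (inj₂ (T , eq , p))) = T , inj₂
          (All.map (λ e → ≤-trans (n≤1+n T) (≤-reflexive (sym (trans e eq))) , ≤-reflexive (trans e eq)) (exact ∷ all) , p)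
        cases : _ → _
        cases (T , inj₁ (all , p)) = from₀ (subst (λ T → All (λ c → length c ≡ T) fix) (sym τ≡T) all)
          (phase₀-step {u = length unf′} remaining (subst (λ T → Phase₀ T _ _) (sym τ≡T) p′) loss≤1 2*loss≤τ)
          where
          p′ = subst (λ u → Phase₀ T u (total unf)) (sym count′) p
          τ≡T = phase₀-average p′ lo-bound hi-bound
        cases (T , inj₂ (all , p)) with phase₁-step {u = length unf′} remaining (subst (λ u → Phase₁ T u (total unf)) (sym count′) p) lo-bound hi-bound loss≤1
        ... | T≤τ , τ≤sT , p′ = T , inj₂
          ((subst (T ≤_) (sym exact) T≤τ , subst (_≤ suc T) (sym exact) τ≤sT) ∷ all , p′)

      low-valid : All Valid (a ∷ lo)
      low-valid = subst (All Valid) lo-eq (Allₚ.filter⁺ (low? τ) valid₁)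

      high-valid : All Valid (b ∷ hi)
      high-valid = subst (All Valid) hi-eq (Allₚ.filter⁺ (high? τ) valid₁)

      replaced : Invariant (unf′ , c ∷ fix)
      replaced = record
        { phase = phase′
        ; some = s≤s z≤n
        ; count = trans (+-suc (length unf′) (length fix)) (trans (cong (_+ length fix) count′) count)
        ; valid₁ = cut-valid₂ ∷ Allₚ.++⁺ (All.tail low-valid) (All.tail high-valid)
        ; valid₂ = cut-valid₁ ∷ valid₂
        ; mass≤ = mass′
        ; price = price′
        }

    module _ (s : State) (inv : Invariant s) where
      open Invariant inv
      private
        unf = proj₁ s
        fix = proj₂ s
        τ = average unf

      total≤n : total unf ≤ n
      total≤n = ≤-trans (m≤m+n (total unf) (total fix)) (≤-trans (mass≤ one) small)

      average-bounds : length unf * τ ≤ total unf × total unf < length unf * suc τ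
      average-bounds = average-spec unf some total≤n

      low-nonempty : ¬ (filter (low? τ) unf ≡ [])
      -- Chains all longer than `τ` would have a total of at least `length unf * suc τ`. The empty
      -- filter is turned into a fact about every chain by taking the predicate `const ⊥`.
      low-nonempty eq = <⇒≱ (proj₂ average-bounds) (length*≤sumBy length
        (All.map ≰⇒> (all-filter⁻ (low? τ) {Q = const ⊥} unf (subst (All (const ⊥)) (sym eq) []))))

      stepWith-spec : ∀ k lo hi → filter (low? τ) unf ≡ lo → filter (high? τ) unf ≡ hi → Progress k s →
                      Invariant (stepWith τ s lo hi) × Progress (suc k) (stepWith τ s lo hi)
      stepWith-spec k []       hi       lo-eq hi-eq _ = contradiction lo-eq low-nonempty
      stepWith-spec k (a ∷ lo) []       lo-eq hi-eq _ = inv , inj₁ hi-eq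
      stepWith-spec k (a ∷ lo) (b ∷ hi) lo-eq hi-eq p = R.replaced , next p
        where
        a≤τ : length a ≤ τ
        a≤τ = All.head (subst (All (λ c → length c ≤ τ)) lo-eq (Allₚ.all-filter (low? τ) unf))
        τ<b : τ < length b
        τ<b = All.head (subst (All (λ c → suc τ ≤ length c)) hi-eq (Allₚ.all-filter (high? τ) unf))
        module R = Replace inv average-bounds lo-eq hi-eq
          (cut-spec (All.head (subst (All Valid) lo-eq (Allₚ.filter⁺ (low? τ) valid₁)))
                    (All.head (subst (All Valid) hi-eq (Allₚ.filter⁺ (high? τ) valid₁))) a≤τ (<⇒≤ τ<b))
        next : Progress k s → Progress (suc k) (stepWith τ s (a ∷ lo) (b ∷ hi))
        next (inj₁ eq) = contradiction (trans (sym hi-eq) eq) λ ()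
        next (inj₂ le) = inj₂ (≤-trans (≤-reflexive (trans (+-suc _ k) (cong (_+ k) R.count′))) le)

      -- With no chain above the rounded average the total leaves no room for one below it, so all
      -- remaining chains have length `τ`; the phase places `τ` among the two values allowed.
      finished : filter (high? τ) unf ≡ [] → Equitable (unf ++ fix)
      finished eq = cases phase
        where
        level : All (λ c → length c ≡ τ) unf
        level = sumBy-tight length
          (All.map ≮⇒≥ (all-filter⁻ (high? τ) {Q = const ⊥} unf (subst (All (const ⊥)) (sym eq) [])))
          (proj₁ average-bounds)
        cases : _ → _
        cases (T , inj₁ (all , p)) = T , All.map (λ e → ≤-reflexive (sym e) , ≤-trans (≤-reflexive e) (n≤1+n T))
          (Allₚ.++⁺ (All.map (λ e → trans e (phase₀-average p (proj₁ average-bounds) (proj₂ average-bounds))) level) all)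
        cases (T , inj₂ (all , δ , R+δ , δ≤1)) = T , Allₚ.++⁺ (All.map (λ e → subst (T ≤_) (sym e) T≤τ , subst (_≤ suc T) (sym e) τ≤sT) level) all
          where
          open ≤-Reasoning
          open +-*-Solver
          u = length unf
          R = total unf
          -- Since `δ` is at most 1 and some chain remains, the total is at least `u * T`.
          T≤τ : T ≤ τ
          T≤τ = *-suc-cancel u (+-cancelʳ-≤ δ _ _ (begin
            u * T + δ        ≤⟨ +-monoʳ-≤ (u * T) (≤-trans δ≤1 some) ⟩
            u * T + u        ≡⟨ solve 2 (λ u T → u :* T :+ u := u :* (con 1 :+ T)) refl u T ⟩
            u * suc T        ≡⟨ sym R+δ ⟩
            R + δ            ∎)) (proj₂ average-bounds)
          τ≤sT : τ ≤ suc T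
          τ≤sT = *-cancelˡ-≤ u {{>-nonZero some}} (≤-trans (proj₁ average-bounds) (≤-trans (m≤m+n R δ) (≤-reflexive R+δ)))

    step-spec : ∀ {s k} → Invariant s × Progress k s → Invariant (step s) × Progress (suc k) (step s)
    step-spec {s} {k} (inv , progress) = stepWith-spec s inv k _ _ refl refl progress

    module _ (nonempty : 1 ≤ length cs₀) (valid₀ : All Valid cs₀) where

      initial : Invariant (cs₀ , [])
      initial = record
        { phase = T , inj₁ ([] , R ∸ u * T , sym (m+[n∸m]≡n (proj₁ bounds)) , m<n+o⇒m∸n<o R (u * T) {{>-nonZero nonempty}} (<-≤-trans (proj₂ bounds)
            (≤-reflexive (solve 2 (λ u T → u :* (con 1 :+ T) := u :* T :+ u) refl u T))))
        ; some = nonempty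
        ; count = +-identityʳ _
        ; valid₁ = valid₀
        ; valid₂ = []
        ; mass≤ = λ w → ≤-reflexive (+-identityʳ _)
        ; price = m≤m+n _ _
        }
        where
        open +-*-Solver
        u = length cs₀
        R = total cs₀
        T = average cs₀
        bounds = average-spec cs₀ nonempty small

      iterate : ∀ (xs : List Chain) → let s = foldr (λ _ → step) (cs₀ , []) xs in
                Invariant s × Progress (length xs) s
      iterate [] = initial , inj₂ (≤-reflexive (+-identityʳ _))
      iterate (_ ∷ xs) = step-spec (iterate xs)

      record Balanced (cs : List Chain) : Set where
        field
          equitable : Equitable cs
          valid     : All Valid cs
          count     : length cs ≡ length cs₀
          mass≤     : ∀ w → mass w cs ≤ mass w cs₀
          price     : 2 * total cs₀ ≤ 3 * total cs

      balance-spec : Balanced (balance cs₀)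
      balance-spec with iterate cs₀
      ... | inv , progress = record
        { equitable = finished _ inv (settled progress)
        ; valid = Allₚ.++⁺ valid₁ valid₂
        ; count = trans (length-++ unf) count
        ; mass≤ = λ w → ≤-trans (≤-reflexive (sumBy-++ (sumBy w) unf fix)) (mass≤ w)
        ; price = begin
            2 * total cs₀                    ≤⟨ price ⟩
            2 * total unf + 3 * total fix    ≤⟨ +-monoˡ-≤ (3 * total fix) (*-monoˡ-≤ (total unf) (n≤1+n 2)) ⟩
            3 * total unf + 3 * total fix    ≡⟨ sym (*-distribˡ-+ 3 (total unf) (total fix)) ⟩
            3 * (total unf + total fix)      ≡⟨ cong (3 *_) (sym (sumBy-++ length unf fix)) ⟩
            3 * total (unf ++ fix)           ∎
        }
        where
        open Invariant inv
        open ≤-Reasoning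
        s = foldr (λ _ → step) (cs₀ , []) cs₀
        unf = proj₁ s
        fix = proj₂ s
        -- Fixing as many chains as there were would leave none, against `some`.
        settled : Progress (length cs₀) s → filter (high? (average unf)) unf ≡ []
        settled (inj₁ eq) = eq
        settled (inj₂ le) = contradiction le (<⇒≱ (+-monoˡ-≤ (length cs₀) some))

-- From lists of chains to schedules

sum-indicator : ∀ {n} (x : Fin n) → sum (λ j → indicator (j Fin.≟ x)) ≡ 1
sum-indicator {suc n} zero    = cong suc (sum-replicate-zero n)
sum-indicator {suc n} (suc x) = sum-indicator x

sumBy-tabulate : ∀ {A : Set} {n} (w : A → ℕ) (f : Fin n → A) → sumBy w (tabulate f) ≡ sum (w ∘ f)
sumBy-tabulate {n = zero}  w f = refl
sumBy-tabulate {n = suc n} w f = cong (w (f zero) +_) (sumBy-tabulate w (f ∘ suc))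

card-sum : ∀ {n} (S : Subset n) → ∣ S ∣ ≡ sum (λ j → if lookup S j then 1 else 0)
card-sum []          = refl
card-sum (true ∷ S)  = cong suc (card-sum S)
card-sum (false ∷ S) = card-sum S

utility-card : ∀ {n} (S : Subset n) → utility unitWeights S ≡ fromℕ ∣ S ∣
utility-card []          = refl
utility-card (true ∷ S)  = trans (cong (1ℚ ℚ.+_) (utility-card S)) (fromℕ-+ 1 ∣ S ∣)
utility-card (false ∷ S) = trans (ℚₚ.+-identityˡ _) (utility-card S)

fromℕ-pred : ∀ {a b} → a ≤ suc b → fromℕ a ℚ.- 1ℚ ℚ.≤ fromℕ b
fromℕ-pred {a} {b} a≤ = begin
  fromℕ a ℚ.- 1ℚ                 ≤⟨ ℚₚ.+-monoˡ-≤ (ℚ.- 1ℚ) (fromℕ-mono-≤ a≤) ⟩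
  fromℕ (suc b) ℚ.- 1ℚ           ≡⟨ cong (λ q → fromℕ q ℚ.- 1ℚ) (+-comm 1 b) ⟩
  fromℕ (b + 1) ℚ.- 1ℚ           ≡⟨ cong (ℚ._- 1ℚ) (sym (fromℕ-+ b 1)) ⟩
  fromℕ b ℚ.+ 1ℚ ℚ.- 1ℚ          ≡⟨ ℚₚ.+-assoc (fromℕ b) 1ℚ (ℚ.- 1ℚ) ⟩
  fromℕ b ℚ.+ 0ℚ                 ≡⟨ ℚₚ.+-identityʳ (fromℕ b) ⟩
  fromℕ b ∎
  where open ℚₚ.≤-Reasoning

∈⇒lookup : ∀ {n} {j : Fin n} {S : Subset n} → j Subset.∈ S → lookup S j ≡ true
∈⇒lookup = Vecₚ.[]=⇒lookup

module Assigning {n : ℕ} (I : Instance n) where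

  open Algorithm I

  is : Fin n → Fin n → ℕ
  is j k = indicator (j Fin.≟ k)

  occurrences : Fin n → Chain → ℕ
  occurrences j = sumBy (is j)

  -- The default makes machines beyond the end of the list empty.
  nth : List Chain → ℕ → Chain
  nth []       _       = []
  nth (c ∷ cs) zero    = c
  nth (c ∷ cs) (suc k) = nth cs k

  position : Fin n → (cs : List Chain) → ∀ {m} → length cs ≤ m → Maybe (Fin m)
  position j []       _         = nothing
  position j (c ∷ cs) (s≤s len) =
    if does (1 ≤? occurrences j c) then just zero else Maybe.map suc (position j cs len)

  occurs⇒∈ : ∀ {j} c → 1 ≤ occurrences j c → j ∈ c
  occurs⇒∈ {j} (x ∷ c) p with j Fin.≟ x
  ... | yes j≡x = here j≡x
  ... | no _    = there (occurs⇒∈ c p)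

  ∈⇒occurs : ∀ {j c} → j ∈ c → 1 ≤ occurrences j c
  ∈⇒occurs {j} {x ∷ c} (here j≡x) = ≤-trans (≤-reflexive (sym (indicator-yes (j Fin.≟ x) j≡x))) (m≤m+n _ _)
  ∈⇒occurs {j} {x ∷ c} (there p)  = ≤-trans (∈⇒occurs p) (m≤n+m _ _)

  nth-occurrences : ∀ j cs k → occurrences j (nth cs k) ≤ mass (is j) cs
  nth-occurrences j []       k       = z≤n
  nth-occurrences j (c ∷ cs) zero    = m≤m+n _ _
  nth-occurrences j (c ∷ cs) (suc k) = ≤-trans (nth-occurrences j cs k) (m≤n+m _ _)

  private
    indicator-suc : ∀ {m} (x : Maybe (Fin m)) i →
                    indicator (≡-dec Fin._≟_ (Maybe.map suc x) (just (suc i))) ≡ indicator (≡-dec Fin._≟_ x (just i))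
    indicator-suc nothing  i = refl
    indicator-suc (just x) i = refl

    indicator-zero : ∀ {m} (x : Maybe (Fin m)) → indicator (≡-dec Fin._≟_ (Maybe.map suc x) (just zero)) ≡ 0
    indicator-zero nothing  = refl
    indicator-zero (just x) = refl

  -- As `j` occurs at most once, the first chain containing it is the only one. Stated with numbers,
  -- the equation gives membership directly and the loads by summation over `j`.
  position-occurrences : ∀ j cs {m} (len : length cs ≤ m) → mass (is j) cs ≤ 1 → ∀ i →
    indicator (≡-dec Fin._≟_ (position j cs len) (just i)) ≡ occurrences j (nth cs (toℕ i))
  position-occurrences j []       len       _  i = refl
  position-occurrences j (c ∷ cs) {suc m} (s≤s len) le i =
    if-elim (λ x → indicator (≡-dec Fin._≟_ x (just i)) ≡ occurrences j (nth (c ∷ cs) (toℕ i)))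
      (1 ≤? occurrences j c) (found i) (skipped i)
    where
    found : ∀ i → 1 ≤ occurrences j c → indicator (≡-dec Fin._≟_ (just zero) (just i)) ≡ occurrences j (nth (c ∷ cs) (toℕ i))
    found zero    p = ≤-antisym p (≤-trans (m≤m+n _ _) le)
    found (suc i) p = sym (n≤0⇒n≡0 (≤-trans (nth-occurrences j cs (toℕ i)) (≤-pred (≤-trans (+-monoˡ-≤ (mass (is j) cs) p) le))))
    skipped : ∀ i → ¬ (1 ≤ occurrences j c) →
              indicator (≡-dec Fin._≟_ (Maybe.map suc (position j cs len)) (just i)) ≡ occurrences j (nth (c ∷ cs) (toℕ i))
    skipped zero    ¬p = trans (indicator-zero (position j cs len)) (sym (n<1⇒n≡0 (≰⇒> ¬p)))
    skipped (suc i) ¬p = trans (indicator-suc (position j cs len) i)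
      (position-occurrences j cs len (≤-trans (m≤n+m _ _) le) i)

  position-just : ∀ j cs {m} (len : length cs ≤ m) → mass (is j) cs ≤ 1 →
    (if is-just (position j cs len) then 1 else 0) ≡ mass (is j) cs
  position-just j []       len       _  = refl
  position-just j (c ∷ cs) (s≤s len) le =
    if-elim (λ x → (if is-just x then 1 else 0) ≡ occurrences j c + mass (is j) cs) (1 ≤? occurrences j c)
      (λ p → ≤-antisym (≤-trans p (m≤m+n _ _)) le)
      (λ ¬p → trans (is-just-map (position j cs len))
        (trans (position-just j cs len (≤-trans (m≤n+m _ _) le)) (cong (_+ mass (is j) cs) (sym (n<1⇒n≡0 (≰⇒> ¬p))))))
    where
    is-just-map : ∀ {m} (x : Maybe (Fin m)) → (if is-just (Maybe.map Fin.suc x) then 1 else 0) ≡ (if is-just x then 1 else 0)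
    is-just-map nothing  = refl
    is-just-map (just _) = refl

  sum-occurrences : ∀ c → sum (λ j → occurrences j c) ≡ length c
  sum-occurrences []      = sum-replicate-zero n
  sum-occurrences (x ∷ c) = trans (∑-distrib-+ (λ j → is j x) (λ j → occurrences j c))
                                  (cong₂ _+_ (sum-indicator x) (sum-occurrences c))

  sum-is : ∀ j → sum (is j) ≡ 1
  sum-is j = trans (sum-cong-≗ flip-is) (sum-indicator j)
    where
    flip-is : ∀ k → is j k ≡ is k j
    flip-is k with j Fin.≟ k | k Fin.≟ j
    ... | yes _   | yes _   = refl
    ... | no _    | no _    = refl
    ... | yes j≡k | no k≢j  = contradiction (sym j≡k) k≢j
    ... | no j≢k  | yes k≡j = contradiction (sym k≡j) j≢k

  sum-mass : ∀ cs → sum (λ j → mass (is j) cs) ≡ total cs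
  sum-mass []       = sum-replicate-zero n
  sum-mass (c ∷ cs) = trans (∑-distrib-+ (λ j → occurrences j c) (λ j → mass (is j) cs))
                            (cong₂ _+_ (sum-occurrences c) (sum-mass cs))

  nth-valid : ∀ {cs} → All Valid cs → ∀ k → Valid (nth cs k)
  nth-valid []       k       = []
  nth-valid (v ∷ vs) zero    = v
  nth-valid (v ∷ vs) (suc k) = nth-valid vs k

  Valid⇒Before : ∀ {c j k} → Valid c → j ∈ c → k ∈ c → j ≢ k → Before j k ⊎ Before k j
  Valid⇒Before (_ ∷ _)  (here refl) (here refl) j≢k = contradiction refl j≢k
  Valid⇒Before (bs ∷ _) (here refl) (there k∈c) _   = inj₁ (All.lookup bs k∈c)
  Valid⇒Before (bs ∷ _) (there j∈c) (here refl) _   = inj₂ (All.lookup bs j∈c)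
  Valid⇒Before (_ ∷ v)  (there j∈c) (there k∈c) j≢k = Valid⇒Before v j∈c k∈c j≢k

  Before⇒¬Overlap : ∀ {j k} → Before j k ⊎ Before k j → ¬ Overlap (lookup I j) (lookup I k)
  Before⇒¬Overlap (inj₁ b) (x , (s≤x , _) , (_ , x<e)) = <⇒≱ℚ x<e (ℚₚ.≤-trans b s≤x)
  Before⇒¬Overlap (inj₂ b) (x , (_ , x<e) , (s≤x , _)) = <⇒≱ℚ x<e (ℚₚ.≤-trans b s≤x)

  -- With the weight `is j` the right side of `mass≤` is 1, so every interval occurs at most once.
  record Plan (m : ℕ) (cs : List Chain) : Set where
    field
      fits  : length cs ≤ m
      valid : All Valid cs
      mass≤ : ∀ w → mass w cs ≤ sum w

  module _ {m cs} (plan : Plan m cs) where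
    open Plan plan

    once : ∀ j → mass (is j) cs ≤ 1
    once j = ≤-trans (mass≤ (is j)) (≤-reflexive (sum-is j))

    assigned : Assignment m n
    assigned = Vec.tabulate (λ j → position j cs fits)

    lookup-assigned : ∀ i j → lookup (assignedTo assigned i) j ≡ does (≡-dec Fin._≟_ (position j cs fits) (just i))
    lookup-assigned i j = trans (Vecₚ.lookup-map j _ assigned)
      (cong (λ x → does (≡-dec Fin._≟_ x (just i))) (Vecₚ.lookup∘tabulate (λ j → position j cs fits) j))

    load : ∀ i → ∣ assignedTo assigned i ∣ ≡ length (nth cs (toℕ i))
    load i = trans (card-sum (assignedTo assigned i)) (trans
      (sum-cong-≗ (λ j → trans (cong (λ b → if b then 1 else 0) (lookup-assigned i j)) (position-occurrences j cs fits (once j) i)))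
      (sum-occurrences (nth cs (toℕ i))))

    assigned⇒∈ : ∀ i {j} → j Subset.∈ assignedTo assigned i → j ∈ nth cs (toℕ i)
    assigned⇒∈ i {j} j∈ = occurs⇒∈ (nth cs (toℕ i)) (≤-reflexive (sym (trans
      (sym (position-occurrences j cs fits (once j) i))
      (cong (λ b → if b then 1 else 0) (trans (sym (lookup-assigned i j)) (∈⇒lookup j∈))))))

    schedule : Schedule m I
    schedule = record
      { assignment = assigned
      ; noOverlap  = λ i j∈ k∈ j≢k → Before⇒¬Overlap
          (Valid⇒Before (nth-valid valid (toℕ i)) (assigned⇒∈ i j∈) (assigned⇒∈ i k∈) j≢k)
      }

    schedule-size : size schedule ≡ total cs
    schedule-size = trans (card-sum (Vec.map is-just assigned)) (trans
      (sum-cong-≗ (λ j → trans (cong (λ b → if b then 1 else 0)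
        (trans (Vecₚ.lookup-map j is-just assigned) (cong is-just (Vecₚ.lookup∘tabulate (λ j → position j cs fits) j))))
        (position-just j cs fits (once j))))
      (sum-mass cs))

    schedule-EF1 : (∀ (i k : Fin m) → length (nth cs (toℕ k)) ≤ suc (length (nth cs (toℕ i)))) → EF1 unitWeights schedule
    schedule-EF1 fair i k _ (j , j∈) = j , j∈ , subst₂ (λ p q → p ℚ.- 1ℚ ℚ.≤ q)
      (sym (trans (utility-card (machine schedule k)) (cong fromℕ (load k))))
      (sym (trans (utility-card (machine schedule i)) (cong fromℕ (load i))))
      (fromℕ-pred (fair i k))

-- Comparing an arbitrary schedule with the greedy one

module Optimality {n : ℕ} (I : Instance n) {m : ℕ} (T : Schedule m I) where

  open Algorithm I
  open Assigning I
  open GreedyOptimality I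

  private
    d : Fin n → Maybe (Fin m)
    d = lookup (assignment T)

  in-machine : ∀ {j i} → d j ≡ just i → j Subset.∈ machine T i
  in-machine {j} {i} eq = Vecₚ.lookup⇒[]= j (machine T i)
    (trans (Vecₚ.lookup-map j _ (assignment T)) (dec-true (≡-dec Fin._≟_ (d j) (just i)) eq))

  private
    E : Chain → Fin m → ℚ
    E = lastEnds m d

  E-origin : ∀ js i → E js i ≡ 0ℚ ⊎ (∃[ k ] k ∈ js × d k ≡ just i × E js i ≡ endOf k)
  E-origin [] i = inj₁ refl
  E-origin (j ∷ js) i with d j in eq | E-origin js i
  ... | nothing | inj₁ p = inj₁ p
  ... | nothing | inj₂ (k , k∈ , q) = inj₂ (k , there k∈ , q)
  ... | just i′ | ih with i Fin.≟ i′
  ...   | yes refl = inj₂ (j , here refl , eq , refl)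
  ...   | no _ with ih
  ...     | inj₁ p = inj₁ p
  ...     | inj₂ (k , k∈ , q) = inj₂ (k , there k∈ , q)

  ordered : ∀ {j k i} → d j ≡ just i → d k ≡ just i → k ≢ j → endOf k ℚ.≤ endOf j → endOf k ℚ.≤ startOf j
  ordered {j} {k} {i} dj dk k≢j ek≤ej with endOf k ℚₚ.≤? startOf j
  ... | yes p = p
  ... | no ¬p = contradiction shared (noOverlap T i (in-machine dk) (in-machine dj) k≢j)
    where
    -- The later of the two starts lies in both intervals.
    shared : Overlap (lookup I k) (lookup I j)
    shared with startOf k ℚₚ.≤? startOf j
    ... | yes sk≤sj = startOf j , (sk≤sj , ℚₚ.≰⇒> ¬p) , (ℚₚ.≤-refl , start<endOf j)
    ... | no sk≰sj  = startOf k , (ℚₚ.≤-refl , start<endOf k) , (≰⇒≥ℚ sk≰sj , ℚₚ.<-≤-trans (start<endOf k) ek≤ej)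

  feasible : ∀ {js} → AllPairs _≽_ js → (∀ j → occurrences j js ≤ 1) → Feasible m d js
  feasible [] _ = []
  feasible {j ∷ js} (p ∷ ps) unique = start-free ∷ feasible ps (λ k → ≤-trans (m≤n+m _ _) (unique k))
    where
    start-free : ∀ i → d j ≡ just i → E js i ℚ.≤ startOf j
    start-free i dj with E-origin js i
    ... | inj₁ E≡0 = subst (ℚ._≤ startOf j) (sym E≡0) (0≤start j)
    ... | inj₂ (k , k∈ , dk , E≡) = subst (ℚ._≤ startOf j) (sym E≡) (ordered dj dk k≢j (All.lookup p k∈))
      where
      k≢j : k ≢ j
      k≢j refl = <⇒≱ (≤-trans (s≤s (∈⇒occurs k∈)) (≤-reflexive (cong (_+ occurrences k js) (sym (indicator-yes (k Fin.≟ k) refl))))) (unique k)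

  size≤greedy : size T ≤ total (run m (sort (allFin n)))
  size≤greedy with run-lead m d (sort-sorted (allFin n)) (feasible (sort-sorted (allFin n)) unique)
    where
    unique : ∀ j → occurrences j (sort (allFin n)) ≤ 1
    unique j = ≤-reflexive (trans (sumBy-sort (is j) (allFin n)) (trans (sumBy-tabulate (is j) (λ k → k))
      (sum-is j)))
  ... | k , size-eq , _ = ≤-trans (≤-reflexive size-sum) (≤-trans (m≤m+n _ k) (≤-reflexive (sym size-eq)))
    where
    size-sum : size T ≡ sumBy (accepted m d) (sort (allFin n))
    size-sum = trans (card-sum (Vec.map is-just (assignment T)))
      (trans (sum-cong-≗ (λ j → cong (λ b → if b then 1 else 0) (Vecₚ.lookup-map j is-just (assignment T))))
        (sym (trans (sumBy-sort (accepted m d) (allFin n)) (sumBy-tabulate (accepted m d) (λ k → k)))))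

-- Fairness and price of the chains

module Solution {n : ℕ} (I : Instance n) where

  open Algorithm I
  open Balance I
  open Assigning I
  open Optimality I
  open GreedyOptimality I

  length-allFin : length (allFin n) ≡ n
  length-allFin = length-tabulate (λ j → j)

  emptyChains-replicate : ∀ m → emptyChains m ≡ replicate (m ⊓ n) []
  emptyChains-replicate m = trans (go (allFin n)) (cong (λ k → replicate (m ⊓ k) []) length-allFin)
    where
    empties : ℕ → List Chain
    empties k = replicate k []
    grow-to : List Chain → List Chain
    grow-to cs = if does (suc (length cs) ≤? m) then [] ∷ cs else cs
    go : ∀ (xs : Chain) → foldr (λ _ → grow-to) [] xs ≡ empties (m ⊓ length xs)
    go [] = cong empties (sym (⊓-zeroʳ m))
    go (x ∷ xs) = trans (cong grow-to (go xs))
      (if-elim (_≡ empties (m ⊓ suc (length xs))) (suc (length (empties (m ⊓ length xs))) ≤? m)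
        (λ p → cong empties (grow (subst (λ k → suc k ≤ m) (length-replicate (m ⊓ length xs)) p)))
        (λ ¬p → cong empties (full (subst (λ k → ¬ (suc k ≤ m)) (length-replicate (m ⊓ length xs)) ¬p))))
      where
      l = length xs
      grow : suc (m ⊓ l) ≤ m → suc (m ⊓ l) ≡ m ⊓ suc l
      grow p with ≤-<-connex m l
      ... | inj₁ m≤l = contradiction p (<⇒≱ (s≤s (≤-reflexive (sym (m≤n⇒m⊓n≡m m≤l)))))
      ... | inj₂ l<m = trans (cong suc (m≥n⇒m⊓n≡n (<⇒≤ l<m))) (sym (m≥n⇒m⊓n≡n l<m))
      full : ¬ (suc (m ⊓ l) ≤ m) → m ⊓ l ≡ m ⊓ suc l
      full ¬p with ≤-<-connex m l
      ... | inj₁ m≤l = trans (m≤n⇒m⊓n≡m m≤l) (sym (m≤n⇒m⊓n≡m (m≤n⇒m≤1+n m≤l)))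
      ... | inj₂ l<m = contradiction (subst (λ k → suc k ≤ m) (sym (m≥n⇒m⊓n≡n (<⇒≤ l<m))) l<m) ¬p

  -- `count` serves the running time: the program loops over the list of chains for every interval.
  record Solves (m : ℕ) (cs : List Chain) : Set where
    field
      plan         : Plan m cs
      fair         : ∀ (i k : Fin m) → length (nth cs (toℕ k)) ≤ suc (length (nth cs (toℕ i)))
      count        : length cs ≤ n
      near-optimal : ∀ (T : Schedule m I) → 2 * size T ≤ 3 * total cs

  run-mass : ∀ m w js → mass w (run m js) ≤ sumBy w js
  run-mass m w []       = ≤-reflexive (empty m)
    where
    empty : ∀ m → mass w (replicate m []) ≡ 0
    empty zero    = refl
    empty (suc m) = empty m
  run-mass m w (j ∷ js) = ≤-trans (place-mass w j (run m js)) (+-monoʳ-≤ (w j) (run-mass m w js))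

  sum-allFin : ∀ w → sumBy w (allFin n) ≡ sum w
  sum-allFin w = sumBy-tabulate w (λ j → j)

  module _ {m : ℕ} (m≤n : m ≤ n) where

    greedy-run : greedy m ≡ run m (sort (allFin n))
    greedy-run = cong (λ cs → foldr place cs (sort (allFin n)))
      (trans (emptyChains-replicate m) (cong (λ k → replicate k []) (m≤n⇒m⊓n≡m m≤n)))

    greedy-length : length (greedy m) ≡ m
    greedy-length = trans (cong length greedy-run) (run-length m (sort (allFin n)))

    greedy-mass : ∀ w → mass w (greedy m) ≤ sum w
    greedy-mass w = begin
      mass w (greedy m)                    ≡⟨ cong (mass w) greedy-run ⟩
      mass w (run m (sort (allFin n)))     ≤⟨ run-mass m w (sort (allFin n)) ⟩
      sumBy w (sort (allFin n))            ≡⟨ sumBy-sort w (allFin n) ⟩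
      sumBy w (allFin n)                   ≡⟨ sum-allFin w ⟩
      sum w                                ∎
      where open ≤-Reasoning

    greedy-small : total (greedy m) ≤ n
    greedy-small = ≤-trans (greedy-mass one) (≤-trans (≤-reflexive (sym (sum-allFin one))) (≤-reflexive length-allFin))

    module _ (m≥1 : 1 ≤ m) where

      private
        balanced : Balanced (greedy m) greedy-small (subst (1 ≤_) (sym greedy-length) m≥1)
                     (subst (All Valid) (sym greedy-run) (run-valid m (sort (allFin n)))) (balance (greedy m))
        balanced = balance-spec (greedy m) greedy-small (subst (1 ≤_) (sym greedy-length) m≥1)
                     (subst (All Valid) (sym greedy-run) (run-valid m (sort (allFin n))))

      open Balanced balanced

      nth-between : ∀ {T cs} → All (Between T) cs → ∀ k → k < length cs → Between T (nth cs k)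
      nth-between (b ∷ bs) zero    _         = b
      nth-between (b ∷ bs) (suc k) (s≤s k<l) = nth-between bs k k<l

      balanced-solves : Solves m (balance (greedy m))
      balanced-solves = record
        { plan = record
          { fits = ≤-reflexive (trans count greedy-length)
          ; valid = valid
          ; mass≤ = λ w → ≤-trans (mass≤ w) (greedy-mass w)
          }
        ; count = ≤-trans (≤-reflexive (trans count greedy-length)) m≤n
        ; fair = λ i k → ≤-trans (proj₂ (between k)) (s≤s (proj₁ (between i)))
        ; near-optimal = λ T → ≤-trans (*-monoʳ-≤ 2 (≤-trans (size≤greedy T) (≤-reflexive (cong total (sym greedy-run))))) price
        }
        where
        between : ∀ (i : Fin m) → Between (proj₁ equitable) (nth (balance (greedy m)) (toℕ i))
        between i = nth-between (proj₂ equitable) (toℕ i) (subst (toℕ i <_) (sym (trans count greedy-length)) (Finₚ.toℕ<n i))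

  singletons-solve : ∀ {m} → n ≤ m → Solves m (map [_] (allFin n))
  singletons-solve {m} n≤m = record
    { plan = record
      { fits = ≤-trans (≤-reflexive (trans (length-map [_] (allFin n)) length-allFin)) n≤m
      ; valid = Allₚ.map⁺ (All.universal (λ _ → [] ∷ []) (allFin n))
      ; mass≤ = λ w → ≤-reflexive (trans (mass-singletons w (allFin n)) (sum-allFin w))
      }
    ; count = ≤-reflexive (trans (length-map [_] (allFin n)) length-allFin)
    ; fair = λ i k → ≤-trans (short (allFin n) (toℕ k)) (s≤s z≤n)
    ; near-optimal = λ T → *-mono-≤ (n≤1+n 2) (≤-trans (∣p∣≤n (Vec.map is-just (assignment T)))
        (≤-reflexive (sym (trans (mass-singletons one (allFin n)) length-allFin))))
    }
    where
    mass-singletons : ∀ w js → mass w (map [_] js) ≡ sumBy w js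
    mass-singletons w []       = refl
    mass-singletons w (j ∷ js) = cong₂ _+_ (+-identityʳ (w j)) (mass-singletons w js)
    short : ∀ js k → length (nth (map [_] js) k) ≤ 1
    short []       k       = z≤n
    short (j ∷ js) zero    = ≤-refl
    short (j ∷ js) (suc k) = short js k

  chains-solve : ∀ m .{{_ : NonZero m}} → Solves m (chains m)
  chains-solve m = if-elim (Solves m) (n ≤? m) singletons-solve
    (λ n≰m → balanced-solves (<⇒≤ (≰⇒> n≰m)) (>-nonZero⁻¹ m))

equitableSchedule : OfflineAlgorithm
equitableSchedule m I = schedule (Solves.plan (chains-solve m))
  where
  open Solution I
  open Assigning I

equitableSchedule-EF1 : ∀ m .{{_ : NonZero m}} {n} (I : Instance n) → EF1 unitWeights (equitableSchedule m I)
equitableSchedule-EF1 m I = schedule-EF1 plan fair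
  where
  open Solution I
  open Assigning I
  open Solves (chains-solve m)

price-bound : ∀ a b → 2 * a ≤ 3 * b → fromℕ a ℚ.≤ (ℤ.+ 3 ℚ./ 2) ℚ.* fromℕ b
price-bound a b 2a≤3b = ℚₚ.*-cancelˡ-≤-pos (fromℕ 2) (begin
  fromℕ 2 ℚ.* fromℕ a                       ≡⟨ fromℕ-* 2 a ⟩
  fromℕ (2 * a)                             ≤⟨ fromℕ-mono-≤ 2a≤3b ⟩
  fromℕ (3 * b)                             ≡⟨ sym (fromℕ-* 3 b) ⟩
  fromℕ 3 ℚ.* fromℕ b                       ≡⟨⟩
  (fromℕ 2 ℚ.* (ℤ.+ 3 ℚ./ 2)) ℚ.* fromℕ b     ≡⟨ ℚₚ.*-assoc (fromℕ 2) (ℤ.+ 3 ℚ./ 2) (fromℕ b) ⟩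
  fromℕ 2 ℚ.* ((ℤ.+ 3 ℚ./ 2) ℚ.* fromℕ b)     ∎)
  where
  open ℚₚ.≤-Reasoning
  fromℕ-* : ∀ k a → fromℕ k ℚ.* fromℕ a ≡ fromℕ (k * a)
  fromℕ-* zero    a = ℚₚ.*-zeroˡ (fromℕ a)
  fromℕ-* (suc k) a = trans (cong (ℚ._* fromℕ a) (sym (fromℕ-+ 1 k)))
    (trans (ℚₚ.*-distribʳ-+ (fromℕ a) 1ℚ (fromℕ k))
      (trans (cong₂ ℚ._+_ (ℚₚ.*-identityˡ (fromℕ a)) (fromℕ-* k a)) (fromℕ-+ a (k * a))))

equitableSchedule-price : PriceOfFairnessAtMost (ℤ.+ 3 ℚ./ 2) equitableSchedule
equitableSchedule-price m I OPT _ = price-bound (size OPT) (size (equitableSchedule m I))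
  (subst (λ k → 2 * size OPT ≤ 3 * k) (sym (schedule-size plan)) (near-optimal OPT))
  where
  open Solution I
  open Assigning I
  open Solves (chains-solve m)

-- The program

labelᴾ startᴾ endᴾ lastEndᴾ notᴾ : ∀ {k} → Exp k → Exp k
labelᴾ x = hd x
startᴾ x = hd (tl x)
endᴾ x = tl (tl x)
lastEndᴾ c = if c (endᴾ (hd c)) (num 0ℚ)
notᴾ b = if b nil (cons nil nil)

sucᴾ : ∀ {k} → Exp k → Exp k
sucᴾ e = add (num 1ℚ) e

-- Identical intervals must be told apart, so each is tagged with the number of intervals after it,
-- which is the length of the accumulator when it is reached.
itemsᴾ : ∀ {k} → Exp k → Exp k
itemsᴾ l = foldrᴾ (cons (cons (lengthᴾ (var (# 0))) (var (# 1))) (var (# 0))) l nil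

-- Every loop shifts the outer variables by three: in the filters, `var (# 4)` is the interval being
-- inserted.
sortᴾ : ∀ {k} → Exp k → Exp k
sortᴾ l = foldrᴾ
  (filterᴾ (notᴾ (leq (endᴾ (var (# 1))) (endᴾ (var (# 4))))) (var (# 0))
    ++ᴾ cons (var (# 1)) (filterᴾ (leq (endᴾ (var (# 1))) (endᴾ (var (# 4)))) (var (# 0))))
  l nil

-- Environment: chains, interval, loop state.
placeᴾ : ∀ {k} → Exp (3 + k)
placeᴾ = let′ (filterᴾ (leq (lastEndᴾ (var (# 1))) (startᴾ (var (# 4)))) (var (# 0)))
  (if (var (# 0))
      (cons (cons (var (# 2)) (hd (var (# 0))))
            (filterᴾ (notᴾ (leq (lastEndᴾ (var (# 1))) (startᴾ (var (# 5))))) (var (# 1)) ++ᴾ tl (var (# 0))))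
      (var (# 1)))

-- Environment: intervals, input.
emptyChainsᴾ : Exp 2
emptyChainsᴾ = foldrᴾ (if (leq (sucᴾ (lengthᴾ (var (# 0)))) (hd (var (# 4)))) (cons nil (var (# 0))) (var (# 0)))
                      (var (# 0)) nil

-- Environment: state, chain, loop state, greedy chains, intervals.
averageᴾ : ∀ {k} → Exp (5 + k)
averageᴾ = foldrᴾ
  (if (leq (foldrᴾ (add (sucᴾ (var (# 3))) (var (# 0))) (hd (var (# 3))) (num 0ℚ))
           (foldrᴾ (add (lengthᴾ (var (# 1))) (var (# 0))) (hd (var (# 3))) (num 0ℚ)))
      (sucᴾ (var (# 0)))
      (var (# 0)))
  (var (# 4)) (num 0ℚ)

-- The first variable is the time.
afterᴾ beforeᴾ : ∀ {k} → Exp (suc k) → Exp (suc k)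
afterᴾ l  = filterᴾ (leq (var (# 3)) (startᴾ (var (# 1)))) l
beforeᴾ l = filterᴾ (leq (endᴾ (var (# 1))) (var (# 3))) l

-- Environment: high chains, low chains, average.
cutPointᴾ : ∀ {k} → Exp (3 + k)
cutPointᴾ = foldrᴾ
  (if (leq (add (lengthᴾ (var (# 0))) (let′ (lastEndᴾ (var (# 0))) (lengthᴾ (afterᴾ (hd (var (# 5))))))) (var (# 5)))
      (var (# 0))
      (tl (var (# 0))))
  (hd (var (# 0))) (hd (var (# 0)))

cutᴾ : ∀ {k} → Exp (3 + k)
cutᴾ = if (leq (var (# 2)) (lengthᴾ (hd (var (# 1)))))
  (cons (hd (var (# 1))) (hd (var (# 0))))
  (let′ cutPointᴾ (let′ (lastEndᴾ (var (# 0)))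
    (cons (afterᴾ (hd (var (# 3))) ++ᴾ var (# 1))
          (afterᴾ (hd (var (# 2))) ++ᴾ beforeᴾ (hd (var (# 3)))))))

-- Environment: state, chain, loop state, greedy chains, intervals.
stepᴾ : ∀ {k} → Exp (5 + k)
stepᴾ =
  let′ averageᴾ
  (let′ (filterᴾ (leq (lengthᴾ (var (# 1))) (var (# 3))) (hd (var (# 1))))
  (let′ (filterᴾ (leq (sucᴾ (var (# 4))) (lengthᴾ (var (# 1)))) (hd (var (# 2))))
  (if (var (# 1))
      (if (var (# 0))
          (let′ cutᴾ (cons (cons (tl (var (# 0))) (tl (var (# 2)) ++ᴾ tl (var (# 1))))
                           (cons (hd (var (# 0))) (tl (var (# 4))))))
          (var (# 3)))
      (var (# 3)))))

-- Environment: greedy chains, intervals.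
balanceᴾ : ∀ {k} → Exp (2 + k)
balanceᴾ = let′ (foldrᴾ stepᴾ (var (# 0)) (cons (var (# 0)) nil)) (hd (var (# 0)) ++ᴾ tl (var (# 0)))

-- Environment: intervals, input.
singletonsᴾ balancedᴾ chainsᴾ : Exp 2
singletonsᴾ = foldrᴾ (cons (cons (var (# 1)) nil) (var (# 0))) (var (# 0)) nil
balancedᴾ   = let′ (foldrᴾ placeᴾ (sortᴾ (var (# 0))) emptyChainsᴾ) balanceᴾ
chainsᴾ     = if (leq (lengthᴾ (var (# 0))) (hd (var (# 1)))) singletonsᴾ balancedᴾ

-- Environment: position, chain, loop state, output, interval.
occurrencesᴾ : ∀ {k} → Exp (5 + k)
occurrencesᴾ = foldrᴾ
  (if (if (leq (labelᴾ (var (# 1))) (labelᴾ (var (# 7)))) (leq (labelᴾ (var (# 7))) (labelᴾ (var (# 1)))) nil)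
      (sucᴾ (var (# 0)))
      (var (# 0)))
  (var (# 1)) (num 0ℚ)

-- Environment: output, interval, loop state, chains.  The successor of nil,
-- which encodes the absence of a position, is nil.
positionᴾ : ∀ {k} → Exp (4 + k)
positionᴾ = foldrᴾ (if (leq (num 1ℚ) occurrencesᴾ) (num 0ℚ) (sucᴾ (var (# 0)))) (var (# 3)) nil

scheduleᴾ : Program
scheduleᴾ = let′ (itemsᴾ (tl (var (# 0)))) (let′ chainsᴾ (foldrᴾ (cons positionᴾ (var (# 0))) (var (# 1)) nil))

-- Correctness and cost of the program

module Correctness {n : ℕ} (I : Instance n) (K : ℕ) (n≤K : n ≤ K) where

  open Algorithm I
  open Evaluation K
  open Assigning I
  open Solution I using (length-allFin)

  label : Fin n → ℕ
  label j = n ∸ suc (toℕ j)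

  encItem : Fin n → Value
  encItem j = cons (encodeℕ (label j)) (encodeInterval (lookup I j))

  encChain : Chain → Value
  encChain = encodeList-map encItem

  encChains : List Chain → Value
  encChains = encodeList-map encChain

  encState : State → Value
  encState s = cons (encChains (proj₁ s)) (encChains (proj₂ s))

  private variable
    k : ℕ
    ρ : Vec Value k
    e f l : Exp k

  lastEndᴱ : ∀ c → ρ ⊢ e ↓ encChain c → ρ ⊢ lastEndᴾ e ↓ num (lastEnd c)
  lastEndᴱ []      d = if-falseᴱ d refl (numᴱ 0ℚ)
  lastEndᴱ (j ∷ c) d = if-trueᴱ d refl (tlᴱ (tlᴱ (hdᴱ d)))

  notᴱ : ∀ {P : Set} (P? : Dec P) → ρ ⊢ e ↓ encodeBool P? → ρ ⊢ notᴾ e ↓ encodeBool (¬? P?)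
  notᴱ (yes _) d = if-trueᴱ d refl nilᴱ
  notᴱ (no _)  d = if-falseᴱ d refl (consᴱ nilᴱ nilᴱ)

  sucᴱ : ∀ a → ρ ⊢ e ↓ encodeℕ a → ρ ⊢ sucᴾ e ↓ encodeℕ (suc a)
  sucᴱ a d = addℕᴱ 1 a (numᴱ 1ℚ) d

  if-encode : ∀ {B : Set} (enc : B → Value) b {x y} → (if b then enc x else enc y) ≡ enc (if b then x else y)
  if-encode enc true  = refl
  if-encode enc false = refl

  ifᴱ′ : ∀ {B : Set} (enc : B → Value) b {c : Exp k} {x y} → ρ ⊢ c ↓ truth b → ρ ⊢ e ↓ enc x → ρ ⊢ f ↓ enc y →
         ρ ⊢ if c e f ↓ enc (if b then x else y)
  ifᴱ′ enc b d d₁ d₂ = subst↓ (if-encode enc b) (ifᴱ b d d₁ d₂)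

  length-sort : ∀ js → length (sort js) ≡ length js
  length-sort = sumBy-sort one

  sortᴱ : ∀ js → length js ≤ K → ρ ⊢ l ↓ encChain js → ρ ⊢ sortᴾ l ↓ encChain (sort js)
  sortᴱ js len d = foldrᴱ encItem encChain ⊤ₚ js (all⊤ js) len (λ j ys s _ _ ys<K →
    let acc = sort ys
        acc≤K = ≤-trans (≤-reflexive (length-sort ys)) (<⇒≤ ys<K)
        late? = λ i → endOf i ℚₚ.≤? endOf j in
    ++ᴱ encItem (filter (¬? ∘ late?) acc) (j ∷ filter late? acc)
      (≤-trans (length-filter (¬? ∘ late?) acc) acc≤K)
      (filterᴱ encItem (¬? ∘ late?) ⊤ₚ acc (all⊤ acc) acc≤K
        (λ i _ _ _ → notᴱ (late? i) (leqℚᴱ (endOf i) (endOf j) (tlᴱ (tlᴱ (varᴱ (# 1)))) (tlᴱ (tlᴱ (varᴱ (# 4))))))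
        (varᴱ (# 0)))
      (consᴱ (varᴱ (# 1))
        (filterᴱ encItem late? ⊤ₚ acc (all⊤ acc) acc≤K
          (λ i _ _ _ → leqℚᴱ (endOf i) (endOf j) (tlᴱ (tlᴱ (varᴱ (# 1)))) (tlᴱ (tlᴱ (varᴱ (# 4)))))
          (varᴱ (# 0)))))
    d nilᴱ

  Small : Chain → Set
  Small c = length c ≤ K

  placeᴱ : ∀ j cs s → length cs ≤ K → (encChains cs ∷ encItem j ∷ s ∷ ρ) ⊢ placeᴾ ↓ encChains (place j cs)
  placeᴱ {ρ = ρ} j cs s len = letᴱ
    (filterᴱ encChain fit? ⊤ₚ cs (all⊤ cs) len
      (λ c _ _ _ → leqℚᴱ (lastEnd c) (startOf j) (lastEndᴱ c (varᴱ (# 1))) (hdᴱ (tlᴱ (varᴱ (# 4))))) (varᴱ (# 0)))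
    (rest (filter fit? cs))
    where
    fit? = λ c → lastEnd c ℚₚ.≤? startOf j
    rest : ∀ fit → (encChains fit ∷ encChains cs ∷ encItem j ∷ s ∷ ρ) ⊢ _ ↓ encChains (placeIn j cs fit)
    rest []        = if-falseᴱ (varᴱ (# 0)) refl (varᴱ (# 1))
    rest (c ∷ fit) = if-trueᴱ (varᴱ (# 0)) refl (consᴱ (consᴱ (varᴱ (# 2)) (hdᴱ (varᴱ (# 0))))
      (++ᴱ encChain (filter (¬? ∘ fit?) cs) fit (≤-trans (length-filter (¬? ∘ fit?) cs) len)
        (filterᴱ encChain (¬? ∘ fit?) ⊤ₚ cs (all⊤ cs) len
          (λ c _ _ _ → notᴱ (fit? c) (leqℚᴱ (lastEnd c) (startOf j) (lastEndᴱ c (varᴱ (# 1))) (hdᴱ (tlᴱ (varᴱ (# 5))))))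
          (varᴱ (# 1)))
        (tlᴱ (varᴱ (# 0)))))

  private
    fill : ℕ → Fin n → List Chain → List Chain
    fill m _ cs = if does (suc (length cs) ≤? m) then [] ∷ cs else cs

  length-fill : ∀ m js → length (foldr (fill m) [] js) ≤ length js
  length-fill m [] = z≤n
  length-fill m (j ∷ js) = if-elim (λ cs → length cs ≤ suc (length js)) (suc (length (foldr (fill m) [] js)) ≤? m)
    (λ _ → s≤s (length-fill m js)) (λ _ → m≤n⇒m≤1+n (length-fill m js))

  allFin≤K : length (allFin n) ≤ K
  allFin≤K = ≤-trans (≤-reflexive length-allFin) n≤K

  emptyChainsᴱ : ∀ m {v} → (encChain (allFin n) ∷ cons (encodeℕ m) v ∷ []) ⊢ emptyChainsᴾ ↓ encChains (emptyChains m)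
  emptyChainsᴱ m = foldrᴱ encItem encChains ⊤ₚ {f = fill m} {i = []} (allFin n) (all⊤ (allFin n)) allFin≤K
    (λ j ys s _ _ ys<K →
      let cs = foldr (fill m) [] ys in
      ifᴱ′ encChains (does (suc (length cs) ≤? m))
        (leqℕᴱ (suc (length cs)) m
          (sucᴱ (length cs) (lengthᴱ encChain cs (≤-trans (length-fill m ys) (<⇒≤ ys<K)) (varᴱ (# 0)))) (hdᴱ (varᴱ (# 4))))
        (consᴱ nilᴱ (varᴱ (# 0))) (varᴱ (# 0)))
    (varᴱ (# 0)) nilᴱ

  -- The language has no multiplication; the program adds `k` once per chain.
  product : ∀ k (cs : List Chain) → foldr (λ _ r → k + r) 0 cs ≡ length cs * k
  product k []       = refl
  product k (c ∷ cs) = cong (k +_) (product k cs)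

  averageᴱ : ∀ s {x st g} → length (proj₁ s) ≤ K → All Small (proj₁ s) →
             (encState s ∷ x ∷ st ∷ g ∷ encChain (allFin n) ∷ ρ) ⊢ averageᴾ ↓ encodeℕ (average (proj₁ s))
  averageᴱ s len small = foldrᴱ encItem encodeℕ ⊤ₚ {f = try} {i = 0} (allFin n) (all⊤ (allFin n)) allFin≤K
    (λ j ys _ _ _ _ →
      let τ = foldr try 0 ys in
      ifᴱ′ encodeℕ (does (length cs * suc τ ≤? total cs))
        (leqℕᴱ (length cs * suc τ) (total cs)
          (subst↓ (cong encodeℕ (product (suc τ) cs))
            (foldrᴱ encChain encodeℕ ⊤ₚ {f = λ _ r → suc τ + r} {i = 0} cs (all⊤ cs) len
              (λ _ zs _ _ _ _ → addℕᴱ (suc τ) (foldr (λ _ r → suc τ + r) 0 zs) (sucᴱ τ (varᴱ (# 3))) (varᴱ (# 0)))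
              (hdᴱ (varᴱ (# 3))) (numᴱ 0ℚ)))
          (foldrᴱ encChain encodeℕ Small {f = λ c r → length c + r} {i = 0} cs small len
            (λ c zs _ c≤K _ _ → addℕᴱ (length c) (total zs) (lengthᴱ encItem c c≤K (varᴱ (# 1))) (varᴱ (# 0)))
            (hdᴱ (varᴱ (# 3))) (numᴱ 0ℚ)))
        (sucᴱ τ (varᴱ (# 0))) (varᴱ (# 0)))
    (varᴱ (# 4)) (numᴱ 0ℚ)
    where
    cs = proj₁ s
    try : Fin n → ℕ → ℕ
    try _ τ = if does (length cs * suc τ ≤? total cs) then suc τ else τ

  afterᴱ : ∀ t c → Small c → (num t ∷ ρ) ⊢ l ↓ encChain c → (num t ∷ ρ) ⊢ afterᴾ l ↓ encChain (after t c)
  afterᴱ t c c≤K d = filterᴱ encItem (λ j → t ℚₚ.≤? startOf j) ⊤ₚ c (all⊤ c) c≤K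
    (λ j _ _ _ → leqℚᴱ t (startOf j) (varᴱ (# 3)) (hdᴱ (tlᴱ (varᴱ (# 1))))) d

  beforeᴱ : ∀ t c → Small c → (num t ∷ ρ) ⊢ l ↓ encChain c → (num t ∷ ρ) ⊢ beforeᴾ l ↓ encChain (before t c)
  beforeᴱ t c c≤K d = filterᴱ encItem (λ j → endOf j ℚₚ.≤? t) ⊤ₚ c (all⊤ c) c≤K
    (λ j _ _ _ → leqℚᴱ (endOf j) t (tlᴱ (tlᴱ (varᴱ (# 1)))) (varᴱ (# 3))) d

  Small-after : ∀ t c → Small c → Small (after t c)
  Small-after t c = ≤-trans (length-filter (λ j → t ℚₚ.≤? startOf j) c)

  tail-drop : ∀ c → tail (encChain c) ≡ encChain (drop 1 c)
  tail-drop []      = refl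
  tail-drop (_ ∷ _) = refl

  module _ (τ : ℕ) (a b : Chain) (a≤K : Small a) (b≤K : Small b) {lo hi : List Chain} where

    private
      next : Fin n → Chain → Chain
      next _ b′ = if does (cutSize a b′ ≤? τ) then b′ else drop 1 b′

      length-next : ∀ ys → length (foldr next b ys) ≤ length b
      length-next [] = ≤-refl
      length-next (y ∷ ys) = if-elim (λ c → length c ≤ length b) (cutSize a (foldr next b ys) ≤? τ)
        (λ _ → length-next ys) (λ _ → shorter (foldr next b ys) (length-next ys))
        where
        shorter : ∀ c → length c ≤ length b → length (drop 1 c) ≤ length b
        shorter []      p = p
        shorter (_ ∷ c) p = ≤-trans (n≤1+n _) p

    cutPointᴱ : (encChains (b ∷ hi) ∷ encChains (a ∷ lo) ∷ encodeℕ τ ∷ ρ) ⊢ cutPointᴾ ↓ encChain (cutPoint τ a b)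
    cutPointᴱ = foldrᴱ encItem encChain ⊤ₚ {f = next} {i = b} b (all⊤ b) b≤K
      (λ _ ys _ _ _ _ →
        let b′ = foldr next b ys in
        ifᴱ′ encChain (does (cutSize a b′ ≤? τ))
          (leqℕᴱ (cutSize a b′) τ
            (addℕᴱ (length b′) (length (after (lastEnd b′) a))
              (lengthᴱ encItem b′ (≤-trans (length-next ys) b≤K) (varᴱ (# 0)))
              (letᴱ (lastEndᴱ b′ (varᴱ (# 0)))
                (lengthᴱ encItem (after (lastEnd b′) a) (Small-after (lastEnd b′) a a≤K)
                  (afterᴱ (lastEnd b′) a a≤K (hdᴱ (varᴱ (# 5)))))))
            (varᴱ (# 5)))
          (varᴱ (# 0))
          (subst↓ (tail-drop b′) (tlᴱ (varᴱ (# 0)))))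
      (hdᴱ (varᴱ (# 0))) (hdᴱ (varᴱ (# 0)))

    encCut : Chain × Chain → Value
    encCut (c , d) = cons (encChain c) (encChain d)

    cutᴱ : (encChains (b ∷ hi) ∷ encChains (a ∷ lo) ∷ encodeℕ τ ∷ ρ) ⊢ cutᴾ ↓ encCut (cut τ a b)
    cutᴱ = ifᴱ′ encCut (does (τ ≤? length a))
      (leqℕᴱ τ (length a) (varᴱ (# 2)) (lengthᴱ encItem a a≤K (hdᴱ (varᴱ (# 1)))))
      (consᴱ (hdᴱ (varᴱ (# 1))) (hdᴱ (varᴱ (# 0))))
      (letᴱ cutPointᴱ (letᴱ (lastEndᴱ b₁ (varᴱ (# 0)))
        (consᴱ
          (++ᴱ encItem (after t a) b₁ (Small-after t a a≤K) (afterᴱ t a a≤K (hdᴱ (varᴱ (# 3)))) (varᴱ (# 1)))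
          (++ᴱ encItem (after t b) (before t a) (Small-after t b b≤K)
            (afterᴱ t b b≤K (hdᴱ (varᴱ (# 2)))) (beforeᴱ t a a≤K (hdᴱ (varᴱ (# 3))))))))
      where
      b₁ = cutPoint τ a b
      t = lastEnd b₁

  stepᴱ : ∀ s {x st g} → length (proj₁ s) ≤ K → All Small (proj₁ s) →
          (encState s ∷ x ∷ st ∷ g ∷ encChain (allFin n) ∷ ρ) ⊢ stepᴾ ↓ encState (step s)
  stepᴱ {ρ = ρ} s {x} {st} {g} len small =
    letᴱ (averageᴱ s len small)
    (letᴱ (filterᴱ encChain low? Small cs small len
      (λ c _ _ c≤K → leqℕᴱ (length c) τ (lengthᴱ encItem c c≤K (varᴱ (# 1))) (varᴱ (# 3))) (hdᴱ (varᴱ (# 1))))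
    (letᴱ (filterᴱ encChain high? Small cs small len
      (λ c _ _ c≤K → leqℕᴱ (suc τ) (length c) (sucᴱ τ (varᴱ (# 4))) (lengthᴱ encItem c c≤K (varᴱ (# 1)))) (hdᴱ (varᴱ (# 2))))
    (rest (filter low? cs) (filter high? cs)
      (≤-trans (length-filter low? cs) len) (Allₚ.filter⁺ low? small) (Allₚ.filter⁺ high? small))))
    where
    cs = proj₁ s
    τ = average cs
    low? = λ (c : Chain) → length c ≤? τ
    high? = λ (c : Chain) → suc τ ≤? length c
    rest : ∀ lo hi → length lo ≤ K → All Small lo → All Small hi →
           (encChains hi ∷ encChains lo ∷ encodeℕ τ ∷ encState s ∷ x ∷ st ∷ g ∷ encChain (allFin n) ∷ ρ) ⊢ _
           ↓ encState (stepWith τ s lo hi)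
    rest []       hi       _     _          _          = if-falseᴱ (varᴱ (# 1)) refl (varᴱ (# 3))
    rest (a ∷ lo) []       _     _          _          = if-trueᴱ (varᴱ (# 1)) refl (if-falseᴱ (varᴱ (# 0)) refl (varᴱ (# 3)))
    rest (a ∷ lo) (b ∷ hi) lo≤K (a≤K ∷ _) (b≤K ∷ _) = if-trueᴱ (varᴱ (# 1)) refl (if-trueᴱ (varᴱ (# 0)) refl
      (letᴱ (cutᴱ τ a b a≤K b≤K {lo} {hi})
        (consᴱ (consᴱ (tlᴱ (varᴱ (# 0))) (++ᴱ encChain lo hi (<⇒≤ lo≤K) (tlᴱ (varᴱ (# 2))) (tlᴱ (varᴱ (# 1)))))
               (consᴱ (hdᴱ (varᴱ (# 0))) (tlᴱ (varᴱ (# 4)))))))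

  module _ (cs : List Chain) (total≤n : total cs ≤ n) (nonempty : 1 ≤ length cs) (valid : All Valid cs) (len : length cs ≤ K) where

    open Balance I using (Invariant; iterate)

    private
      state : List Chain → State
      state = foldr (λ _ → step) (cs , [])

      unfixed≤ : ∀ ys → length (proj₁ (state ys)) ≤ K
      unfixed≤ ys = ≤-trans (≤-trans (m≤m+n _ _) (≤-reflexive (Invariant.count inv))) len
        where inv = proj₁ (iterate cs total≤n nonempty valid ys)

      unfixed-small : ∀ ys → All Small (proj₁ (state ys))
      unfixed-small ys = sumBy-each length (proj₁ (state ys))
        (≤-trans (m≤m+n _ _) (≤-trans (Invariant.mass≤ inv one) (≤-trans total≤n n≤K)))
        where inv = proj₁ (iterate cs total≤n nonempty valid ys)

    -- The lists must stay short in every round: `count` bounds the number of remaining chains and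
    -- `mass≤` with weight `one` the length of each.
    balanceᴱ : (encChains cs ∷ encChain (allFin n) ∷ ρ) ⊢ balanceᴾ ↓ encChains (balance cs)
    balanceᴱ = letᴱ
      (foldrᴱ encChain encState ⊤ₚ {f = λ _ → step} {i = cs , []} cs (all⊤ cs) len
        (λ _ ys _ _ _ _ → stepᴱ (state ys) (unfixed≤ ys) (unfixed-small ys))
        (varᴱ (# 0)) (consᴱ (varᴱ (# 0)) nilᴱ))
      (++ᴱ encChain (proj₁ (state cs)) (proj₂ (state cs)) (unfixed≤ cs) (hdᴱ (varᴱ (# 0))) (tlᴱ (varᴱ (# 0))))

  module _ (m : ℕ) .{{_ : NonZero m}} where

    open Solution I using (greedy-run; greedy-length; greedy-small)
    open GreedyOptimality I using (run-valid)

    private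
      run≤K : ∀ js → length (foldr place (emptyChains m) js) ≤ K
      run≤K []       = ≤-trans (length-fill m (allFin n)) allFin≤K
      run≤K (j ∷ js) = ≤-trans (≤-reflexive (length-place j (foldr place (emptyChains m) js))) (run≤K js)

    chainsᴱ : ∀ {v} → (encChain (allFin n) ∷ cons (encodeℕ m) v ∷ []) ⊢ chainsᴾ ↓ encChains (chains m)
    chainsᴱ = branch (n ≤? m) (subst↓ (cong (λ k → encodeBool (k ≤? m)) length-allFin)
        (leqℕᴱ (length (allFin n)) m (lengthᴱ encItem (allFin n) allFin≤K (varᴱ (# 0))) (hdᴱ (varᴱ (# 1)))))
      where
      singletons : ∀ {ρ : Vec Value 2} → (js : Chain) → length js ≤ K → ρ ⊢ var (# 0) ↓ encChain js →
                   ρ ⊢ singletonsᴾ ↓ encChains (map [_] js)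
      singletons js len d = subst↓ (cong encChains (as-map js))
        (foldrᴱ encItem encChains ⊤ₚ {f = λ j cs → [ j ] ∷ cs} {i = []} js (all⊤ js) len
          (λ _ _ _ _ _ _ → consᴱ (consᴱ (varᴱ (# 1)) nilᴱ) (varᴱ (# 0))) d nilᴱ)
        where
        as-map : ∀ js → foldr (λ j cs → [ j ] ∷ cs) [] js ≡ map [_] js
        as-map []       = refl
        as-map (j ∷ js) = cong ([ j ] ∷_) (as-map js)
      branch : ∀ {v} {c : Exp 2} (d : Dec (n ≤ m)) → (encChain (allFin n) ∷ cons (encodeℕ m) v ∷ []) ⊢ c ↓ encodeBool d →
               (encChain (allFin n) ∷ cons (encodeℕ m) v ∷ []) ⊢ if c singletonsᴾ balancedᴾ ↓
               encChains (if does d then map [_] (allFin n) else balance (greedy m))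
      branch (yes _) c↓ = if-trueᴱ c↓ refl (singletons (allFin n) allFin≤K (varᴱ (# 0)))
      branch (no n≰m) c↓ = if-falseᴱ c↓ refl (letᴱ
        (foldrᴱ encItem encChains ⊤ₚ {f = place} {i = emptyChains m} (sort (allFin n)) (all⊤ (sort (allFin n)))
          (≤-trans (≤-reflexive (length-sort (allFin n))) allFin≤K)
          (λ j ys s _ _ _ → placeᴱ j (foldr place (emptyChains m) ys) s (run≤K ys))
          (sortᴱ (allFin n) allFin≤K (varᴱ (# 0))) (emptyChainsᴱ m))
        (balanceᴱ (greedy m) (greedy-small m≤n) (subst (1 ≤_) (sym (greedy-length m≤n)) (>-nonZero⁻¹ m))
          (subst (All Valid) (sym (greedy-run m≤n)) (run-valid m (sort (allFin n)))) (run≤K (sort (allFin n)))))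
        where
        m≤n : m ≤ n
        m≤n = <⇒≤ (≰⇒> n≰m)

  does-cong : ∀ {P Q : Set} (P? : Dec P) (Q? : Dec Q) → (P → Q) → (Q → P) → does P? ≡ does Q?
  does-cong (yes p) (yes q) f g = refl
  does-cong (yes p) (no ¬q) f g = contradiction (f p) ¬q
  does-cong (no ¬p) (yes q) f g = contradiction (g q) ¬p
  does-cong (no ¬p) (no ¬q) f g = refl

  -- Equality of intervals is tested by comparing their labels both ways, which is sound because
  -- distinct indices have distinct labels.
  occurrencesᴱ : ∀ j c {v st out} → Small c →
                 (v ∷ encChain c ∷ st ∷ out ∷ encItem j ∷ ρ) ⊢ occurrencesᴾ ↓ encodeℕ (occurrences j c)
  occurrencesᴱ j c c≤K = foldrᴱ encItem encodeℕ ⊤ₚ {f = λ i r → is j i + r} {i = 0} c (all⊤ c) c≤K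
    (λ i ys _ _ _ _ →
      let r = occurrences j ys
          i≤j? = label i ≤? label j
          j≤i? = label j ≤? label i in
      subst↓ (cong encodeℕ (trans (choose (does (i≤j? ×-dec j≤i?)) r)
               (cong (λ b → (if b then 1 else 0) + r) (does-cong (i≤j? ×-dec j≤i?) (j Fin.≟ i) (same i) same⁻¹))))
        (ifᴱ′ encodeℕ (does (i≤j? ×-dec j≤i?))
          (subst↓ (both (does i≤j?) (does j≤i?))
            (ifᴱ (does i≤j?)
              (leqℕᴱ (label i) (label j) (hdᴱ (varᴱ (# 1))) (hdᴱ (varᴱ (# 7))))
              (leqℕᴱ (label j) (label i) (hdᴱ (varᴱ (# 7))) (hdᴱ (varᴱ (# 1))))
              nilᴱ))
          (sucᴱ r (varᴱ (# 0))) (varᴱ (# 0))))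
    (varᴱ (# 1)) (numᴱ 0ℚ)
    where
    choose : ∀ b r → (if b then suc r else r) ≡ (if b then 1 else 0) + r
    choose true  r = refl
    choose false r = refl
    both : ∀ b c → (if b then truth c else nil) ≡ truth (b ∧ c)
    both true  c = refl
    both false c = refl
    same : ∀ i → label i ≤ label j × label j ≤ label i → j ≡ i
    same i (p , q) = Finₚ.toℕ-injective (suc-injective (∸-cancelˡ-≡ (Finₚ.toℕ<n j) (Finₚ.toℕ<n i) (≤-antisym q p)))
    same⁻¹ : ∀ {i} → j ≡ i → label i ≤ label j × label j ≤ label i
    same⁻¹ refl = ≤-refl , ≤-refl

  encPosition : Maybe ℕ → Value
  encPosition nothing  = nil
  encPosition (just k) = encodeℕ k

  private
    locate : Fin n → Chain → Maybe ℕ → Maybe ℕ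
    locate j c r = if does (1 ≤? occurrences j c) then just 0 else Maybe.map suc r

  positionᴱ : ∀ j cs {v st} → length cs ≤ K → All Small cs →
              (v ∷ encItem j ∷ st ∷ encChains cs ∷ ρ) ⊢ positionᴾ ↓ encPosition (foldr (locate j) nothing cs)
  positionᴱ j cs len small = foldrᴱ encChain encPosition Small {f = locate j} {i = nothing} cs small len
    (λ c ys _ c≤K _ _ → ifᴱ′ encPosition (does (1 ≤? occurrences j c))
      (leqℕᴱ 1 (occurrences j c) (numᴱ 1ℚ) (occurrencesᴱ j c c≤K))
      (numᴱ 0ℚ) (next (foldr (locate j) nothing ys) (varᴱ (# 0))))
    (varᴱ (# 3)) nilᴱ
    where
    next : ∀ {k} {ρ : Vec Value k} {e} r → ρ ⊢ e ↓ encPosition r → ρ ⊢ sucᴾ e ↓ encPosition (Maybe.map suc r)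
    next nothing  d = addᴱ (numᴱ 1ℚ) d
    next (just k) d = sucᴱ k d

  -- `position` takes a bound on the number of chains and returns an element of `Fin m`; the program
  -- computes only the number, which `locate` describes.
  locate-position : ∀ j cs {m} (fits : length cs ≤ m) →
                    encPosition (foldr (locate j) nothing cs) ≡ encodeMachine (position j cs fits)
  locate-position j cs fits = trans (cong encPosition (go cs fits)) (encode (position j cs fits))
    where
    encode : ∀ {m} (x : Maybe (Fin m)) → encPosition (Maybe.map toℕ x) ≡ encodeMachine x
    encode nothing  = refl
    encode (just i) = refl
    map-suc : ∀ {m} (x : Maybe (Fin m)) → Maybe.map suc (Maybe.map toℕ x) ≡ Maybe.map toℕ (Maybe.map Fin.suc x)
    map-suc nothing  = refl
    map-suc (just i) = refl
    if-map : ∀ {m} b (x : Maybe (Fin m)) → (if b then just 0 else Maybe.map suc (Maybe.map toℕ x)) ≡ Maybe.map toℕ (if b then just zero else Maybe.map Fin.suc x)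
    if-map true  x = refl
    if-map false x = map-suc x
    go : ∀ cs {m} (fits : length cs ≤ m) → foldr (locate j) nothing cs ≡ Maybe.map toℕ (position j cs fits)
    go []       fits       = refl
    go (c ∷ cs) (s≤s fits) = trans (cong (locate j c) (go cs fits)) (if-map (does (1 ≤? occurrences j c)) (position j cs fits))

  indexed : ∀ {k} → Vec Interval k → List (ℕ × Interval)
  indexed L = foldr (λ J acc → (length acc , J) ∷ acc) [] (Vec.toList L)

  indexed-tabulate : ∀ {k} (L : Vec Interval k) → indexed L ≡ tabulate (λ j → k ∸ suc (toℕ j) , lookup L j)
  indexed-tabulate [] = refl
  indexed-tabulate {suc k} (J ∷ L) = cong₂ (λ l acc → (l , J) ∷ acc)
    (trans (cong length (indexed-tabulate L)) (length-tabulate _)) (indexed-tabulate L)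

  encIndexed : ℕ × Interval → Value
  encIndexed (l , J) = cons (encodeℕ l) (encodeInterval J)

  indexed-items : encodeList-map encIndexed (indexed I) ≡ encChain (allFin n)
  indexed-items = cong encodeList (trans (cong (map encIndexed) (indexed-tabulate I))
    (trans (map-tabulate _ encIndexed) (sym (map-tabulate (λ j → j) encItem))))

  toList-intervals : Vec.toList (Vec.map encodeInterval I) ≡ map encodeInterval (Vec.toList I)
  toList-intervals = Vecₚ.toList-map encodeInterval I

  itemsᴱ : ∀ m → (encodeInput m I ∷ []) ⊢ itemsᴾ (tl (var (# 0))) ↓ encChain (allFin n)
  itemsᴱ m = subst↓ indexed-items
    (foldrᴱ encodeInterval (encodeList-map encIndexed) ⊤ₚ {f = λ J acc → (length acc , J) ∷ acc} {i = []}
      (Vec.toList I) (all⊤ (Vec.toList I)) (≤-trans (≤-reflexive (Vecₚ.length-toList I)) n≤K)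
      (λ J ys _ _ _ ys<K →
        let acc = foldr (λ J acc → (length acc , J) ∷ acc) [] ys in
        consᴱ (consᴱ (lengthᴱ encIndexed acc (≤-trans (≤-reflexive (length-indexed ys)) (<⇒≤ ys<K)) (varᴱ (# 0))) (varᴱ (# 1))) (varᴱ (# 0)))
      (subst↓ (cong encodeList toList-intervals) (tlᴱ (varᴱ (# 0)))) nilᴱ)
    where
    length-indexed : ∀ (ys : List Interval) → length (foldr (λ J acc → (length acc , J) ∷ acc) [] ys) ≡ length ys
    length-indexed []       = refl
    length-indexed (_ ∷ ys) = cong suc (length-indexed ys)

  module _ (m : ℕ) .{{_ : NonZero m}} where

    open Solution I using (chains-solve; module Solves)
    open Plan (Solves.plan (chains-solve m)) using (fits; mass≤)

    private
      machineValue : Fin n → Value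
      machineValue j = encPosition (foldr (locate j) nothing (chains m))

      output : encodeList-map machineValue (allFin n) ≡ encodeSchedule (equitableSchedule m I)
      output = cong encodeList (trans (map-tabulate (λ j → j) machineValue) (sym (trans
        (cong Vec.toList (sym (Vecₚ.tabulate-∘ encodeMachine (λ j → position j (chains m) fits))))
        (trans (toList-tabulate _) (tabulate-cong (λ j → sym (locate-position j (chains m) fits)))))))
        where
        toList-tabulate : ∀ {A : Set} {k} (f : Fin k → A) → Vec.toList (Vec.tabulate f) ≡ tabulate f
        toList-tabulate {k = zero}  f = refl
        toList-tabulate {k = suc k} f = cong (f zero ∷_) (toList-tabulate (f ∘ suc))

      chains-count : length (chains m) ≤ K
      chains-count = ≤-trans (Solves.count (chains-solve m)) n≤K

      chains-small : All Small (chains m)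
      chains-small = sumBy-each length (chains m) (≤-trans (mass≤ one) (≤-trans (≤-reflexive (trans (sym (Solution.sum-allFin I one)) length-allFin)) n≤K))

    scheduleᴱ : (encodeInput m I ∷ []) ⊢ scheduleᴾ ↓ encodeSchedule (equitableSchedule m I)
    scheduleᴱ = subst↓ (trans (cong encodeList (as-map (allFin n))) output)
      (letᴱ (itemsᴱ m) (letᴱ (chainsᴱ m)
        (foldrᴱ encItem encodeList ⊤ₚ {f = λ j vs → machineValue j ∷ vs} {i = []} (allFin n) (all⊤ (allFin n)) allFin≤K
          (λ j _ _ _ _ _ → consᴱ (positionᴱ j (chains m) chains-count chains-small) (varᴱ (# 0)))
          (varᴱ (# 1)) nilᴱ)))
      where
      as-map : ∀ js → foldr (λ j vs → machineValue j ∷ vs) [] js ≡ map machineValue js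
      as-map []       = refl
      as-map (j ∷ js) = cong (machineValue j ∷_) (as-map js)

-- Polynomial time in the length of the input

inputLength-list : ∀ vs → length vs ≤ inputLength (encodeList vs)
inputLength-list []       = z≤n
inputLength-list (v ∷ vs) = s≤s (≤-trans (inputLength-list vs) (m≤n+m _ (inputLength v)))

n≤inputLength : ∀ m {n} (I : Instance n) → n ≤ inputLength (encodeInput m I)
n≤inputLength m {n} I = begin
  n                                                     ≡⟨ sym (Vecₚ.length-toList (Vec.map encodeInterval I)) ⟩
  length intervals                                      ≤⟨ inputLength-list intervals ⟩
  inputLength (encodeList intervals)                    ≤⟨ m≤n+m _ (inputLength (num (fromℕ m))) ⟩
  inputLength (num (fromℕ m)) + inputLength (encodeList intervals)  ≤⟨ n≤1+n _ ⟩
  inputLength (encodeInput m I)                         ∎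
  where
  intervals = Vec.toList (Vec.map encodeInterval I)
  open ≤-Reasoning

equitableSchedule-polynomial : PolynomialTime equitableSchedule
equitableSchedule-polynomial = scheduleᴾ , coefficient , degree , λ m I →
  let K = inputLength (encodeInput m I)
      t , run , t≤ = Correctness.scheduleᴱ I K (n≤inputLength m I) m
  -- The encoded input is a `cons`, so its length `K` is a successor and hence nonzero, as `bounded`
  -- requires.
  in t , run , ≤-trans t≤ (bounded K)
  where open PolyBounded (timeBound-poly scheduleᴾ)

open import Data.Integer using (+_)
open import Data.Rational using (_/_)

theorem1 : Σ[ ALG ∈ OfflineAlgorithm ]
    PolynomialTime ALG
    × ((m : ℕ) .{{_ : NonZero m}} {n : ℕ} (I : Instance n) → EF1 unitWeights (ALG m I))
    × PriceOfFairnessAtMost (+ 3 / 2) ALG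
theorem1 = equitableSchedule , equitableSchedule-polynomial , equitableSchedule-EF1 , equitableSchedule-price
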